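{- Let $G$ be a finite simple graph with $\alpha(G)\ge 2$. If $G$ contains no induced cycle $C_\ell$ for any $\ell$ with $4\le \ell\le 2\alpha(G)$, then $G$ contains the complete graph $K_{\chi(G)}$ as an immersion.
   Context: $\alpha(G)$ is the independence number and $\chi(G)$ the chromatic number. A graph $G$ contains a graph $K$ as an immersion if there is an injective map $\phi\colon V(K)\to V(G)$ such that for every edge $uv\in E(K)$ there is a path $P_{uv}$ in $G$ with endpoints $\phi(u),\phi(v)$, the paths $P_{uv}$ ($uv\in E(K)$) are pairwise edge-disjoint, and no vertex of $\phi(V(K))$ (the branch vertices) is an interior vertex of any path $P_{uv}$. -}

module Defs where

open import Data.Nat using (ℕ; suc; _≤_; _<_; _+_; _*_)
open import Data.Fin using (Fin; toℕ)
open import Data.Bool using (Bool; true; false)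
open import Data.List using (List; []; _∷_; length)
open import Data.List.Membership.Propositional using (_∈_)
open import Data.List.Relation.Unary.All using (All)
open import Data.List.Relation.Unary.Unique.Propositional using (Unique)
open import Data.Product using (Σ; _×_; _,_; ∃)
open import Data.Sum using (_⊎_)
open import Relation.Binary.PropositionalEquality using (_≡_; _≢_)
open import Relation.Nullary using (¬_)
open import Function.Definitions using (Injective)

record Graph (n : ℕ) : Set where
  field
    adj   : Fin n → Fin n → Bool
    sym   : ∀ u v → adj u v ≡ adj v u
    irref : ∀ v → adj v v ≡ false
open Graph public

Adj : ∀ {n} → Graph n → Fin n → Fin n → Set
Adj G u v = adj G u v ≡ true

IsIndependent : ∀ {n} → Graph n → List (Fin n) → Set
IsIndependent G S = Unique S × (∀ u v → u ∈ S → v ∈ S → ¬ Adj G u v)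

IndependenceNumber : ∀ {n} → Graph n → ℕ → Set
IndependenceNumber G a =
  (Σ (List _) λ S → IsIndependent G S × length S ≡ a) ×
  (∀ S → IsIndependent G S → length S ≤ a)

IsProperColouring : ∀ {n} → Graph n → (k : ℕ) → (Fin n → Fin k) → Set
IsProperColouring G k c = ∀ u v → Adj G u v → c u ≢ c v

Colourable : ∀ {n} → Graph n → ℕ → Set
Colourable G k = Σ (_ → Fin k) λ c → IsProperColouring G k c

ChromaticNumber : ∀ {n} → Graph n → ℕ → Set
ChromaticNumber G k = Colourable G k × (∀ j → j < k → ¬ Colourable G j)

CycAdj : (ℓ : ℕ) → Fin ℓ → Fin ℓ → Set
CycAdj ℓ i j = (suc (toℕ i) ≡ toℕ j ⊎ suc (toℕ j) ≡ toℕ i)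
             ⊎ ((suc (toℕ i) ≡ ℓ × toℕ j ≡ 0) ⊎ (suc (toℕ j) ≡ ℓ × toℕ i ≡ 0))

-- G contains C_ℓ as an induced subgraph (ℓ ≥ 3 intended).
HasInducedCycle : ∀ {n} → Graph n → ℕ → Set
HasInducedCycle {n} G ℓ =
  Σ (Fin ℓ → Fin n) λ f → Injective _≡_ _≡_ f ×
    (∀ i j → (Adj G (f i) (f j) → CycAdj ℓ i j) × (CycAdj ℓ i j → Adj G (f i) (f j)))

data IsWalk {n} (G : Graph n) : Fin n → Fin n → List (Fin n) → Set where
  single : ∀ x → IsWalk G x x (x ∷ [])
  step   : ∀ {x y z P} → Adj G x y → IsWalk G y z (y ∷ P) → IsWalk G x z (x ∷ y ∷ P)

IsPath : ∀ {n} → Graph n → Fin n → Fin n → List (Fin n) → Set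
IsPath G x y P = IsWalk G x y P × Unique P

interior : ∀ {A : Set} → List A → List A
interior []           = []
interior (x ∷ [])     = []
interior (x ∷ y ∷ []) = []
interior (x ∷ y ∷ z ∷ P) = y ∷ interior (y ∷ z ∷ P)

data UsesEdge {n} (u v : Fin n) : List (Fin n) → Set where
  here-fw : ∀ {P} → UsesEdge u v (u ∷ v ∷ P)
  here-bw : ∀ {P} → UsesEdge u v (v ∷ u ∷ P)
  there   : ∀ {x P} → UsesEdge u v P → UsesEdge u v (x ∷ P)

EdgeDisjoint : ∀ {n} → List (Fin n) → List (Fin n) → Set
EdgeDisjoint P Q = ∀ u v → UsesEdge u v P → ¬ UsesEdge u v Q

ImmersesComplete : ∀ {n} → Graph n → ℕ → Set
ImmersesComplete {n} G m =
  Σ (Fin m → Fin n) λ φ → Injective _≡_ _≡_ φ ×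
  Σ ((i j : Fin m) → toℕ i < toℕ j → List (Fin n)) λ path →
    (∀ i j (p : toℕ i < toℕ j) → IsPath G (φ i) (φ j) (path i j p)) ×
    (∀ i j (p : toℕ i < toℕ j) i' j' (p' : toℕ i' < toℕ j') →
       ¬ (i ≡ i' × j ≡ j') → EdgeDisjoint (path i j p) (path i' j' p')) ×
    (∀ i j (p : toℕ i < toℕ j) k → ¬ (φ k ∈ interior (path i j p)))

{-# OPTIONS --safe #-}
-- Show for every k that G is k-colourable or immerses K_{k+1}. If G has no hole (induced cycle
-- of length at least 4), then removing simplicial vertices one by one either colours G greedily
-- or exhibits a clique of size k + 1. Otherwise every hole has length 2α + 1, since a longer one
-- would contain too large an independent set. Such a hole forces the structure of G: it is a
-- clique B joined to a blow-up of the odd cycle by cliques A 0, ..., A 2α.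
-- With w = k − |B|, two consecutive classes of more than w vertices give a clique of size k + 1.
-- If there is none and the classes have at most α w vertices in total, a circular colouring
-- with w colours exists. If they have more, rotate so that A 0 is smallest; then every even
-- class is so large that B, A 0, A 1 and w + 1 − |A 0| − |A 1| vertices of A 2 are the branch
-- vertices of an immersion, with A 0 and A 2 linked by paths going around the cycle.
module Submission where

open import Defs
open import Data.Nat
open import Data.Nat.Properties
open import Data.Nat.DivMod
open import Data.Fin using (Fin; zero; suc; toℕ; fromℕ<)
import Data.Fin.Properties as Fin
import Data.Bool.Properties as Bool
open import Data.Bool using (true)
open import Data.Maybe using (Maybe; just; nothing)
import Data.Maybe.Properties as Maybe
open import Data.List using (List; []; _∷_; _++_; length; lookup; take; map; filter; allFin; applyUpTo)
open import Data.List.Properties using (length-++; length-applyUpTo; length-filter; length-map; length-take; filter-notAll)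
open import Data.List.Membership.Propositional using (_∈_; _∉_; find; lose)
open import Data.List.Membership.Propositional.Properties using (∈-++⁻; ∈-allFin; ∈-applyUpTo⁻; ∈-filter⁺; ∈-filter⁻; ∈-lookup; ∈-map⁺)
open import Data.List.Membership.DecPropositional _≟_ using (_∈?_)
open import Data.List.Relation.Unary.Any using (Any; here; there; any?; index)
import Data.List.Relation.Unary.Any as Any
open import Data.List.Relation.Unary.Any.Properties using (lookup-index)
open import Data.List.Relation.Unary.All using (All; []; _∷_)
import Data.List.Relation.Unary.All as All
open import Data.List.Relation.Unary.AllPairs using (AllPairs; []; _∷_)
import Data.List.Relation.Unary.AllPairs as AllPairs
import Data.List.Relation.Unary.AllPairs.Properties as AllPairs
open import Data.List.Relation.Unary.Unique.Propositional using (Unique)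
import Data.List.Relation.Unary.Unique.Propositional.Properties as Unique
open import Data.Product using (Σ; _×_; _,_; ∃-syntax; proj₁; proj₂)
open import Data.Sum using (_⊎_; inj₁; inj₂)
open import Data.Empty using (⊥; ⊥-elim)
open import Function using (_∘_)
open import Relation.Binary.Definitions using (tri<; tri≈; tri>)
open import Relation.Binary.PropositionalEquality hiding (sym)
import Relation.Binary.PropositionalEquality as ≡
open import Relation.Nullary using (¬_; Dec; yes; no)
open import Relation.Nullary.Decidable using (_⊎-dec_; _×-dec_; ¬?; decidable-stable)
open import Relation.Unary using (Decidable)

-- Induced paths, cycles and independent sets

-- The threshold `α w` is the most that w colours can bear: an independent set meets at most α of
-- the 2α + 1 classes, in one vertex each. Beyond it, counting supplies the room for detours.
-- Without `A 0`, `A 1` and one even class, the cycle falls into α - 1 pairs of consecutive classes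
-- with at most w vertices each, so the three classes left out hold more than w together. Every even
-- class thus has a q-th vertex for each of the chosen vertices of `A 2`, and minimality of `A 0`
-- gives every odd class a p-th vertex. An edge of the detour (p, q) reveals p at its odd end and q
-- at its even end, which makes the detours edge-disjoint. The structure around the hole rests on
-- two obstructions: an induced cycle that is too short, and an independent set of α + 1 vertices.
-- The first excludes gaps between neighbours on the hole and 4-cycles through two common
-- neighbours; the second excludes vertices with too few neighbours on the hole and non-adjacent
-- vertices in consecutive classes.

least : {Q : ℕ → Set} → Decidable Q → ∀ N →
  (∀ i → i < N → ¬ Q i) ⊎ (∃[ j ] j < N × Q j × (∀ i → i < j → ¬ Q i))
least Q? zero = inj₁ λ _ ()
least Q? (suc N) with least Q? N
... | inj₂ (j , j<N , q , min) = inj₂ (j , m<n⇒m<1+n j<N , q , min)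
... | inj₁ none with Q? N
...   | yes q = inj₂ (N , n<1+n N , q , none)
...   | no ¬q = inj₁ λ i i<1+N → case-≤ (m≤n⇒m<n∨m≡n (≤-pred i<1+N))
  where
  case-≤ : ∀ {i} → i < N ⊎ i ≡ N → ¬ _
  case-≤ (inj₁ i<N) = none _ i<N
  case-≤ (inj₂ refl) = ¬q

greatest : {Q : ℕ → Set} → Decidable Q → ∀ L {s} → s ≤ L → Q s →
  ∃[ j ] j ≤ L × Q j × (∀ i → j < i → i ≤ L → ¬ Q i)
greatest Q? L {s} s≤L q with Q? L
... | yes qL = L , ≤-refl , qL , λ i L<i i≤L _ → <-irrefl refl (<-≤-trans L<i i≤L)
greatest Q? zero z≤n q | no ¬q0 = ⊥-elim (¬q0 q)
greatest {Q} Q? (suc L) s≤L q | no ¬qL with m≤n⇒m<n∨m≡n s≤L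
... | inj₂ refl = ⊥-elim (¬qL q)
... | inj₁ s<1+L with greatest Q? L (≤-pred s<1+L) q
...   | j , j≤L , qj , max = j , m≤n⇒m≤1+n j≤L , qj , max′
  where
  max′ : ∀ i → j < i → i ≤ suc L → ¬ Q i
  max′ i j<i i≤ qi with m≤n⇒m<n∨m≡n i≤
  ... | inj₁ i< = max i j<i (≤-pred i<) qi
  ... | inj₂ refl = ¬qL qi

module _ {n : ℕ} (G : Graph n) where

  Near : Fin n → Fin n → Set
  Near u v = u ≡ v ⊎ Adj G u v

  adj? : ∀ u v → Dec (Adj G u v)
  adj? u v = adj G u v Bool.≟ true

  near? : ∀ u v → Dec (Near u v)
  near? u v = (u Fin.≟ v) ⊎-dec adj? u v

  adj-sym : ∀ {u v} → Adj G u v → Adj G v u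
  adj-sym {u} {v} e = trans (sym G v u) e

  near-sym : ∀ {u v} → Near u v → Near v u
  near-sym (inj₁ e) = inj₁ (≡.sym e)
  near-sym (inj₂ e) = inj₂ (adj-sym e)

  adj⇒≢ : ∀ {u v} → Adj G u v → u ≢ v
  adj⇒≢ {u} e refl with trans (≡.sym e) (irref G u)
  ... | ()

  near⇒adj : ∀ {u v} → u ≢ v → Near u v → Adj G u v
  near⇒adj u≢v (inj₁ e) = ⊥-elim (u≢v e)
  near⇒adj u≢v (inj₂ e) = e

  record InducedPath (L : ℕ) (P : ℕ → Fin n) : Set where
    field
      next : ∀ i → i < L → Adj G (P i) (P (suc i))
      far  : ∀ i j → 2 + i ≤ j → j ≤ L → ¬ Near (P i) (P j)

    adj⇒consecutive : ∀ {i j} → i ≤ L → j ≤ L → Adj G (P i) (P j) → suc i ≡ j ⊎ suc j ≡ i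
    adj⇒consecutive {i} {j} i≤L j≤L e with <-cmp i j
    ... | tri≈ _ refl _ = ⊥-elim (adj⇒≢ e refl)
    ... | tri< i<j _ _ with m≤n⇒m<n∨m≡n i<j
    ...   | inj₁ 2+i≤j = ⊥-elim (far _ _ 2+i≤j j≤L (inj₂ e))
    ...   | inj₂ 1+i≡j = inj₁ 1+i≡j
    adj⇒consecutive {i} {j} i≤L j≤L e | tri> _ _ j<i with m≤n⇒m<n∨m≡n j<i
    ...   | inj₁ 2+j≤i = ⊥-elim (far _ _ 2+j≤i i≤L (inj₂ (adj-sym e)))
    ...   | inj₂ 1+j≡i = inj₂ 1+j≡i

    ordered-≢ : ∀ {i j} → i < j → j ≤ L → P i ≢ P j
    ordered-≢ i<j j≤L e with m≤n⇒m<n∨m≡n i<j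
    ... | inj₁ 2+i≤j = far _ _ 2+i≤j j≤L (inj₁ e)
    ... | inj₂ refl = adj⇒≢ (next _ j≤L) e

    injective : ∀ {i j} → i ≤ L → j ≤ L → P i ≡ P j → i ≡ j
    injective {i} {j} i≤L j≤L e with <-cmp i j
    ... | tri≈ _ i≡j _ = i≡j
    ... | tri< i<j _ _ = ⊥-elim (ordered-≢ i<j j≤L e)
    ... | tri> _ _ j<i = ⊥-elim (ordered-≢ j<i i≤L (≡.sym e))

  -- An induced cycle of length `2 + L` with a marked vertex `r`; `2≤L` makes it a hole. The
  -- arguments below produce cycles in this shape: an induced path of which some vertex sees the two
  -- ends only.
  record Cone (L : ℕ) (P : ℕ → Fin n) (r : Fin n) : Set where
    field
      path  : InducedPath L P
      2≤L   : 2 ≤ L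
      first : Adj G r (P 0)
      last  : Adj G r (P L)
      inner : ∀ i → 0 < i → i < L → ¬ Near r (P i)
    open InducedPath path public

    apex-≢ : ∀ {i} → i ≤ L → r ≢ P i
    apex-≢ {zero} _ = adj⇒≢ first
    apex-≢ {suc i} 1+i≤L with m≤n⇒m<n∨m≡n 1+i≤L
    ... | inj₁ 1+i<L = inner _ z<s 1+i<L ∘ inj₁
    ... | inj₂ refl = adj⇒≢ last

    apex-adj : ∀ {i} → i ≤ L → Adj G r (P i) → i ≡ 0 ⊎ i ≡ L
    apex-adj {zero} _ _ = inj₁ refl
    apex-adj {suc i} 1+i≤L e with m≤n⇒m<n∨m≡n 1+i≤L
    ... | inj₁ 1+i<L = ⊥-elim (inner _ z<s 1+i<L (inj₂ e))
    ... | inj₂ 1+i≡L = inj₂ 1+i≡L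

  cone⇒cycle : ∀ {L P r} → Cone L P r → HasInducedCycle G (2 + L)
  cone⇒cycle {L} {P} {r} cone = f , inj , λ i j → to i j , from i j
    where
    open Cone cone
    f : Fin (2 + L) → Fin n
    f zero = r
    f (suc i) = P (toℕ i)

    bound : (i : Fin (suc L)) → toℕ i ≤ L
    bound i = ≤-pred (Fin.toℕ<n i)

    inj : ∀ {i j} → f i ≡ f j → i ≡ j
    inj {zero} {zero} e = refl
    inj {zero} {suc j} e = ⊥-elim (apex-≢ (bound j) e)
    inj {suc i} {zero} e = ⊥-elim (apex-≢ (bound i) (≡.sym e))
    inj {suc i} {suc j} e = cong suc (Fin.toℕ-injective (injective (bound i) (bound j) e))

    to : ∀ i j → Adj G (f i) (f j) → CycAdj (2 + L) i j
    to zero zero e = ⊥-elim (adj⇒≢ e refl)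
    to zero (suc j) e with apex-adj (bound j) e
    ... | inj₁ q = inj₁ (inj₁ (cong suc (≡.sym q)))
    ... | inj₂ q = inj₂ (inj₂ (cong (2 +_) q , refl))
    to (suc i) zero e with apex-adj (bound i) (adj-sym e)
    ... | inj₁ q = inj₁ (inj₂ (cong suc (≡.sym q)))
    ... | inj₂ q = inj₂ (inj₁ (cong (2 +_) q , refl))
    to (suc i) (suc j) e with adj⇒consecutive (bound i) (bound j) e
    ... | inj₁ q = inj₁ (inj₁ (cong suc q))
    ... | inj₂ q = inj₁ (inj₂ (cong suc q))

    consecutive : ∀ i j → suc (toℕ i) ≡ toℕ j → Adj G (f i) (f j)
    consecutive zero (suc j) q = subst (λ k → Adj G r (P k)) (suc-injective q) first
    consecutive (suc i) (suc j) q = subst (λ k → Adj G (P (toℕ i)) (P k)) (suc-injective q)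
      (next (toℕ i) (subst (_≤ L) (≡.sym (suc-injective q)) (bound j)))

    closing : ∀ i j → suc (toℕ i) ≡ 2 + L → toℕ j ≡ 0 → Adj G (f i) (f j)
    closing (suc i) zero q _ =
      adj-sym (subst (λ k → Adj G r (P k)) (≡.sym (suc-injective (suc-injective q))) last)

    from : ∀ i j → CycAdj (2 + L) i j → Adj G (f i) (f j)
    from i j (inj₁ (inj₁ q)) = consecutive i j q
    from i j (inj₁ (inj₂ q)) = adj-sym (consecutive j i q)
    from i j (inj₂ (inj₁ (p , q))) = closing i j p q
    from i j (inj₂ (inj₂ (p , q))) = adj-sym (closing j i p q)

  independent-applyUpTo : ∀ f N → (∀ i j → i < j → j < N → ¬ Near (f i) (f j)) →
    IsIndependent G (applyUpTo f N)
  independent-applyUpTo f N apart =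
    Unique.applyUpTo⁺₁ f N (λ i<j j<N → apart _ _ i<j j<N ∘ inj₁) , nonadj
    where
    nonadj : ∀ u v → u ∈ applyUpTo f N → v ∈ applyUpTo f N → ¬ Adj G u v
    nonadj u v u∈ v∈ e with ∈-applyUpTo⁻ f u∈ | ∈-applyUpTo⁻ f v∈
    ... | i , i<N , refl | j , j<N , refl with <-cmp i j
    ...   | tri< i<j _ _ = apart _ _ i<j j<N (inj₂ e)
    ...   | tri≈ _ refl _ = adj⇒≢ e refl
    ...   | tri> _ _ j<i = apart _ _ j<i i<N (inj₂ (adj-sym e))

2+2i≤2j : ∀ {i j} → i < j → 2 + 2 * i ≤ 2 * j
2+2i≤2j {i} {j} i<j = subst (_≤ 2 * j) (*-suc 2 i) (*-monoʳ-≤ 2 i<j)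

-- The vertices of a hole are indexed by all of ℕ, with period 2 a + 1.
record Hole {n} (G : Graph n) (a : ℕ) : Set where
  field
    c        : ℕ → Fin n
    periodic : ∀ t → c (suc (2 * a) + t) ≡ c t
    next     : ∀ i → Adj G (c i) (c (suc i))
    far      : ∀ i j → 2 + i ≤ j → j < 2 * a + i → ¬ Near G (c i) (c j)

module WithoutShortHoles {n : ℕ} (G : Graph n) (a : ℕ)
  (bounded : ∀ S → IsIndependent G S → length S ≤ a)
  (holeless : ∀ ℓ → 4 ≤ ℓ → ℓ ≤ 2 * a → ¬ HasInducedCycle G ℓ) where

  independent-≤ : ∀ f N → (∀ i j → i < j → j < N → ¬ Near G (f i) (f j)) → N ≤ a
  independent-≤ f N apart =
    subst (_≤ a) (length-applyUpTo f N) (bounded _ (independent-applyUpTo G f N apart))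

  no-short-cone : ∀ {L P r} → Cone G L P r → ¬ (2 + L ≤ 2 * a)
  no-short-cone cone short =
    holeless _ (s≤s (s≤s (Cone.2≤L cone))) short (cone⇒cycle G cone)

  -- Lengths up to `2 * a` are excluded. If `2 * a ≤ L`, the path vertices of index 0, 2, ...,
  -- `2 * a` are `a + 1` independent vertices.
  cone-length : ∀ {L P r} → Cone G L P r → 2 * a ≡ suc L
  cone-length {L} {P} cone with <-cmp (2 * a) (suc L)
  ... | tri≈ _ eq _ = eq
  ... | tri> _ _ 1+L<2a = ⊥-elim (no-short-cone cone 1+L<2a)
  ... | tri< 2a<1+L _ _ = ⊥-elim (<-irrefl refl (independent-≤ (λ i → P (2 * i)) (suc a)
          λ i j i<j j≤a → far _ _ (2+2i≤2j i<j) (≤-trans (*-monoʳ-≤ 2 (≤-pred j≤a)) (≤-pred 2a<1+L))))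
    where open Cone cone

  cone⇒hole : ∀ {L P r} → Cone G L P r → Hole G a
  cone⇒hole {L} {P} {r} cone = record
    { c = c
    ; periodic = λ t → trans (cong (λ k → c (suc k + t)) 2a≡1+L) (periodic t)
    ; next = λ i → subst (Adj G (c i)) (≡.sym (c-shift 1 i)) (next-rem (i % m) (m%n<n i m))
    ; far = far-c
    }
    where
    open Cone cone
    2a≡1+L = cone-length cone
    m = 2 + L
    g : ℕ → Fin n
    g zero = r
    g (suc i) = P i
    c : ℕ → Fin n
    c t = g (t % m)

    periodic : ∀ t → c (m + t) ≡ c t
    periodic t = cong g (trans (cong (_% m) (+-comm m t)) ([m+n]%n≡m%n t m))

    c-small : ∀ {i} → i < m → c i ≡ g i
    c-small i<m = cong g (m<n⇒m%n≡m i<m)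

    c-shift : ∀ d s → c (d + s) ≡ c (d + s % m)
    c-shift d s = cong g (trans (cong (λ k → (d + k) % m) (m≡m%n+[m/n]*n s m))
      (trans (cong (_% m) (≡.sym (+-assoc d (s % m) _))) ([m+kn]%n≡m%n (d + s % m) (s / m) m)))

    next-rem : ∀ i → i < m → Adj G (g i) (c (suc i))
    next-rem i i<m with m≤n⇒m<n∨m≡n i<m
    next-rem zero i<m | inj₁ 1+i<m = subst (Adj G r) (≡.sym (c-small 1+i<m)) first
    next-rem (suc i) i<m | inj₁ 1+i<m =
      subst (Adj G (P i)) (≡.sym (c-small 1+i<m)) (next i (≤-pred (≤-pred 1+i<m)))
    next-rem (suc i) _ | inj₂ refl =
      subst (Adj G (P i)) (≡.sym (cong g (n%n≡0 m))) (adj-sym G last)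

    -- The cycle closes between `g 0` and `g (suc L)`; the last hypothesis keeps that pair out.
    far-g : ∀ i j → 2 + i ≤ j → j < m → (i ≡ 0 → j < suc L) → ¬ Near G (g i) (g j)
    far-g zero (suc j) (s≤s 1≤j) _ j<L = inner j 1≤j (≤-pred (j<L refl))
    far-g (suc i) (suc j) (s≤s 2+i≤j) j<m _ = far i j 2+i≤j (≤-pred (≤-pred j<m))

    far-rem : ∀ i d → i < m → 2 ≤ d → d < suc L → ¬ Near G (g i) (c (d + i))
    far-rem i d i<m 2≤d d<1+L with d + i <? m
    ... | yes d+i<m = far-g i (d + i) (+-monoˡ-≤ i 2≤d) d+i<m
            (λ { refl → subst (_< suc L) (≡.sym (+-identityʳ d)) d<1+L })
            ∘ subst (Near G (g i)) (c-small d+i<m)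
    -- Past the end of the cycle the position wraps to `x`, which lies `m − d ≥ 2` below `i`, so the
    -- two vertices swap roles.
    ... | no d+i≮m = λ near → far-g x i 2+x≤i i<m x≡0⇒
            (near-sym G (subst (Near G (g i)) c≡gx near))
      where
      m≤d+i = ≮⇒≥ d+i≮m
      x = (d + i) ∸ m
      m+x≡ : m + x ≡ d + i
      m+x≡ = m+[n∸m]≡n m≤d+i
      2+x≤i : 2 + x ≤ i
      2+x≤i = +-cancelˡ-≤ L (2 + x) i (begin
        L + (2 + x) ≡⟨ trans (≡.sym (+-assoc L 2 x)) (cong (_+ x) (+-comm L 2)) ⟩
        m + x ≡⟨ m+x≡ ⟩
        d + i ≤⟨ +-monoˡ-≤ i (≤-pred d<1+L) ⟩
        L + i ∎)
        where open ≤-Reasoning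
      c≡gx : c (d + i) ≡ g x
      c≡gx = trans (cong c (≡.sym m+x≡)) (trans (periodic x) (c-small (≤-trans (m≤n+m (suc x) 1) (≤-trans 2+x≤i (<⇒≤ i<m)))))
      x≡0⇒ : x ≡ 0 → i < suc L
      x≡0⇒ x≡0 = +-cancelˡ-≤ 1 (suc i) (suc L) (begin
        2 + i ≤⟨ +-monoˡ-≤ i 2≤d ⟩
        d + i ≡⟨ ≡.sym m+x≡ ⟩
        m + x ≡⟨ cong (m +_) x≡0 ⟩
        m + 0 ≡⟨ +-identityʳ m ⟩
        m ∎)
        where open ≤-Reasoning

    far-c : ∀ i j → 2 + i ≤ j → j < 2 * a + i → ¬ Near G (c i) (c j)
    far-c i j 2+i≤j j<2a+i near =
      far-rem (i % m) d (m%n<n i m) 2≤d d<1+L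
        (subst (Near G (c i)) (trans (cong c (≡.sym d+i≡j)) (c-shift d i)) near)
      where
      d = j ∸ i
      i≤j : i ≤ j
      i≤j = ≤-trans (m≤n+m i 2) 2+i≤j
      d+i≡j : d + i ≡ j
      d+i≡j = m∸n+n≡m i≤j
      2≤d : 2 ≤ d
      2≤d = +-cancelʳ-≤ i 2 d (subst (2 + i ≤_) (≡.sym d+i≡j) 2+i≤j)
      d<1+L : d < suc L
      d<1+L = +-cancelʳ-< i d (suc L) (subst₂ _<_ (≡.sym d+i≡j) (cong (_+ i) 2a≡1+L) j<2a+i)

-- Simplicial vertices

search : {A : Set} {P : A → Set} → Decidable P → ∀ xs →
  (∃[ x ] x ∈ xs × P x) ⊎ (∀ {x} → x ∈ xs → ¬ P x)
search P? xs with any? P? xs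
... | yes p = inj₁ (find p)
... | no ¬p = inj₂ λ x∈ px → ¬p (lose x∈ px)

_∖_ : ∀ {n} → List (Fin n) → Fin n → List (Fin n)
xs ∖ v = filter (λ x → ¬? (x Fin.≟ v)) xs

∈-remove⁺ : ∀ {n} {xs : List (Fin n)} {v x} → x ∈ xs → x ≢ v → x ∈ xs ∖ v
∈-remove⁺ = ∈-filter⁺ (λ x → ¬? (x Fin.≟ _))

∈-remove⁻ : ∀ {n} {xs : List (Fin n)} {v x} → x ∈ xs ∖ v → x ∈ xs × x ≢ v
∈-remove⁻ = ∈-filter⁻ (λ x → ¬? (x Fin.≟ _))

length-remove : ∀ {n} {xs : List (Fin n)} {v} → v ∈ xs → length (xs ∖ v) < length xs
length-remove v∈ = filter-notAll _ _ (Any.map (λ { refl x≢v → x≢v refl }) v∈)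

module _ {n : ℕ} (G : Graph n) where

  SomeCone : Set
  SomeCone = ∃[ L ] ∃[ P ] ∃[ r ] Cone G L P r

  suffix : ∀ {L P j} → InducedPath G L P → j ≤ L → InducedPath G (L ∸ j) (λ i → P (i + j))
  suffix {L} {P} {j} path j≤L = record
    { next = λ i i< → next (i + j) (subst (i + j <_) (m∸n+n≡m j≤L) (+-monoˡ-< j i<))
    ; far = λ i k 2+i≤k k≤ → far (i + j) (k + j) (+-monoˡ-≤ j 2+i≤k)
              (subst (k + j ≤_) (m∸n+n≡m j≤L) (+-monoˡ-≤ j k≤))
    }
    where open InducedPath path

  Reach : (Fin n → Set) → Fin n → Fin n → Set
  Reach W p q = ∃[ L ] ∃[ P ] InducedPath G L P × P 0 ≡ p × P L ≡ q × (∀ i → i ≤ L → W (P i))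

  reach-refl : ∀ {W p} → W p → Reach W p p
  reach-refl {p = p} w = 0 , (λ _ → p) , record
    { next = λ _ ()
    ; far = λ { i zero () _ ; i (suc j) _ () }
    } , refl , refl , λ _ _ → w

  -- Cutting the path at its last vertex near p keeps it induced.
  reach-step : ∀ {W p q y} → Adj G p q → W p → Reach W q y → Reach W p y
  reach-step {W} {p} adj wp (L , P , path , refl , refl , inW)
    with greatest (λ i → near? G p (P i)) L z≤n (inj₂ adj)
  ... | j , j≤L , inj₁ refl , _ =
        L ∸ j , (λ i → P (i + j)) , suffix path j≤L , refl , cong P (m∸n+n≡m j≤L) ,
        λ i i≤ → inW (i + j) (subst (i + j ≤_) (m∸n+n≡m j≤L) (+-monoˡ-≤ j i≤))
  ... | j , j≤L , inj₂ p~Pj , beyond = suc (L ∸ j) , P′ , record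
          { next = λ { zero _ → p~Pj ; (suc i) i< → tail.next i (≤-pred i<) }
          ; far = λ { zero (suc i) 2≤1+i i≤ → beyond (i + j) (+-monoˡ-≤ j (≤-pred 2≤1+i)) (shift i (≤-pred i≤))
                    ; (suc i) (suc k) 2+i≤k k≤ → tail.far i k (≤-pred 2+i≤k) (≤-pred k≤)
                    ; zero zero () _
                    ; (suc i) zero () _ } } ,
        refl , cong P (m∸n+n≡m j≤L) ,
        λ { zero _ → wp ; (suc i) i≤ → inW (i + j) (shift i (≤-pred i≤)) }
    where
    module tail = InducedPath (suffix path j≤L)
    P′ : ℕ → Fin n
    P′ zero = p
    P′ (suc i) = P (i + j)
    shift : ∀ i → i ≤ L ∸ j → i + j ≤ L
    shift i i≤ = subst (i + j ≤_) (m∸n+n≡m j≤L) (+-monoˡ-≤ j i≤)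

  -- A form of connectedness that avoids walks: it is applied with C p saying that some target
  -- is reached from p by an induced path.
  Connected : List (Fin n) → Set₁
  Connected T = (C : Fin n → Set) →
    (∀ {p q} → p ∈ T → q ∈ T → Adj G p q → C p → C q) → ∀ {p q} → p ∈ T → q ∈ T → C p → C q

  connected-singleton : ∀ v → Connected (v ∷ [])
  connected-singleton v C closed (here refl) (here refl) cp = cp

  connected-∷ : ∀ {T x t} → Connected T → t ∈ T → Adj G x t → Connected (x ∷ T)
  connected-∷ conn t∈ x~t C closed p∈ q∈ = λ cp → fromT q∈ (toT p∈ cp)
    where
    within = conn C (λ p∈ q∈ → closed (there p∈) (there q∈))
    toT : ∀ {p} → p ∈ _ → C p → C _
    toT (here refl) cp = closed (here refl) (there t∈) x~t cp
    toT (there p∈) cp = within p∈ t∈ cp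
    fromT : ∀ {q} → q ∈ _ → C _ → C q
    fromT (here refl) ct = closed (there t∈) (here refl) (adj-sym G x~t) ct
    fromT (there q∈) ct = within t∈ q∈ ct

  Touches : List (Fin n) → Fin n → Set
  Touches T x = Any (Adj G x) T

  touches? : ∀ T → Decidable (Touches T)
  touches? T x = any? (adj? G x) T

  Through : List (Fin n) → Fin n → Fin n → Fin n → Set
  Through T x y p = p ≡ x ⊎ p ≡ y ⊎ p ∈ T

  reach-through : ∀ {T x y} → Connected T → Touches T x → Touches T y → Reach (Through T x y) x y
  reach-through {T} {x} {y} conn tx ty with find tx | find ty
  ... | s , s∈ , x~s | t , t∈ , y~t =
    extend x~s (inj₁ refl)
      (conn (λ p → Reach (Through T x y) p y) (λ p∈ q∈ p~q → extend (adj-sym G p~q) (inj₂ (inj₂ q∈)))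
        t∈ s∈ (extend (adj-sym G y~t) (inj₂ (inj₂ t∈)) (reach-refl {W = Through T x y} (inj₂ (inj₁ refl)))))
    where
    extend : ∀ {p q} → Adj G p q → Through T x y p → Reach (Through T x y) q y → Reach (Through T x y) p y
    extend = reach-step {W = Through T x y}

  -- Connectedness of `T` yields an induced path from `x` to `y` whose inner vertices lie in `T`.
  -- Since `r` sees nothing of `T`, it is the apex of a cone over this path, and non-adjacency of
  -- `x` and `y` makes the path long enough.
  cone-over-connected : ∀ {T x y r} → Connected T → Touches T x → Touches T y →
    (∀ {t} → t ∈ T → ¬ Near G r t) → Adj G r x → Adj G r y → ¬ Near G x y → SomeCone
  cone-over-connected {T} {r = r} conn tx ty r≁T r~x r~y x≁y with reach-through conn tx ty
  ... | L , P , path , refl , refl , inW = L , P , r , record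
          { path = path ; 2≤L = long L path x≁y ; first = r~x ; last = r~y ; inner = inner }
    where
    open InducedPath path
    long : ∀ L → InducedPath G L P → ¬ Near G (P 0) (P L) → 2 ≤ L
    long zero _ x≁y = ⊥-elim (x≁y (inj₁ refl))
    long (suc zero) path x≁y = ⊥-elim (x≁y (inj₂ (InducedPath.next path 0 z<s)))
    long (suc (suc L)) _ _ = s≤s (s≤s z≤n)
    inner : ∀ i → 0 < i → i < L → ¬ Near G r (P i)
    inner i 0<i i<L near with inW i (<⇒≤ i<L)
    ... | inj₁ e = ordered-≢ 0<i (<⇒≤ i<L) (≡.sym e)
    ... | inj₂ (inj₁ e) = ordered-≢ i<L ≤-refl e
    ... | inj₂ (inj₂ ∈T) = r≁T ∈T near

  Simplicial : List (Fin n) → Fin n → Set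
  Simplicial S v = v ∈ S × (∀ {x y} → x ∈ S → y ∈ S → Adj G v x → Adj G v y → Near G x y)

  Outcome : List (Fin n) → Set
  Outcome S = (∃[ v ] Simplicial S v) ⊎ SomeCone

  -- T is grown while the set of vertices of U that T does not touch stays nonempty. Once T is
  -- maximal, every vertex of U touched by T is adjacent to every untouched one.
  module _ {S : List (Fin n)} {k : ℕ} (smaller : ∀ R → length R ≤ k → ∃[ r ] r ∈ R → Outcome R) where

    grow : ∀ f T U → length U ≤ f → length U ≤ k → Connected T →
      (∀ {x} → x ∈ S → x ∈ T ⊎ x ∈ U) → (∀ {x} → x ∈ U → x ∈ S) → (∀ {x} → x ∈ U → x ∉ T) →
      ∃[ w ] w ∈ U × ¬ Touches T w → Outcome S
    grow zero T [] _ _ _ _ _ _ (w , () , _)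
    grow (suc f) T U U≤f U≤k conn cover U⊆S U∌T (w , w∈ , w≁T)
      with search (λ x → touches? T x ×-dec
                     any? (λ y → ¬? (touches? T y) ×-dec ¬? (adj? G x y)) U) U
    ... | inj₁ (x , x∈ , tx , someY) with find someY | find tx
    ...   | y , y∈ , y≁T , x≁y | t , t∈ , x~t =
      grow f (x ∷ T) (U ∖ x) (≤-pred (<-≤-trans (length-remove x∈) U≤f))
        (≤-trans (<⇒≤ (length-remove x∈)) U≤k)
        (connected-∷ conn t∈ x~t) cover′ (U⊆S ∘ proj₁ ∘ ∈-remove⁻) U∌T′
        (y , ∈-remove⁺ y∈ (λ { refl → y≁T tx }) ,
         λ { (here y~x) → x≁y (adj-sym G y~x) ; (there ty) → y≁T ty })
      where
      cover′ : ∀ {z} → z ∈ S → z ∈ x ∷ T ⊎ z ∈ U ∖ x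
      cover′ {z} z∈ with cover z∈ | z Fin.≟ x
      ... | inj₁ z∈T | _ = inj₁ (there z∈T)
      ... | inj₂ z∈U | yes z≡x = inj₁ (here z≡x)
      ... | inj₂ z∈U | no z≢x = inj₂ (∈-remove⁺ z∈U z≢x)
      U∌T′ : ∀ {z} → z ∈ U ∖ x → z ∉ x ∷ T
      U∌T′ z∈ (here z≡x) = proj₂ (∈-remove⁻ {xs = U} z∈) z≡x
      U∌T′ z∈ (there z∈T) = U∌T (proj₁ (∈-remove⁻ z∈)) z∈T
    -- With `T` maximal, induction applies to the untouched part of `U`. Its simplicial vertex `r`
    -- sees no vertex of `T`, so non-adjacent neighbours `x` and `y` of `r` lie in `U`. If both are
    -- touched, they are joined through `T` and give a cone; if one is, maximality makes them
    -- adjacent; if neither is, simpliciality of `r` does.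
    grow (suc f) T U U≤f U≤k conn cover U⊆S U∌T (w , w∈ , w≁T)
      | inj₂ maximal with smaller (filter untouched? U) (≤-trans (length-filter untouched? U) U≤k)
                            (w , ∈-filter⁺ untouched? w∈ w≁T)
      where
      untouched? : Decidable (¬_ ∘ Touches T)
      untouched? x = ¬? (touches? T x)
    ... | inj₂ cone = inj₂ cone
    ... | inj₁ (r , r∈R , simplicial) with ∈-filter⁻ (λ x → ¬? (touches? T x)) {xs = U} r∈R
    ...   | r∈ , r≁T with search (λ x → adj? G r x ×-dec
                        any? (λ y → adj? G r y ×-dec ¬? (near? G x y)) S) S
    ...     | inj₂ none = inj₁ (r , U⊆S r∈ , λ {x} {y} x∈ y∈ r~x r~y → decidable-stable (near? G x y)
                            (λ x≁y → none x∈ (r~x , lose y∈ (r~y , x≁y))))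
    ...     | inj₁ (x , x∈ , r~x , someY) with find someY
    ...       | y , y∈ , r~y , x≁y = inj₂ (handle (touches? T x) (touches? T y))
      where
      inU : ∀ {z} → z ∈ S → Adj G r z → z ∈ U
      inU z∈ r~z with cover z∈
      ... | inj₁ z∈T = ⊥-elim (r≁T (lose z∈T r~z))
      ... | inj₂ z∈U = z∈U
      touched~untouched : ∀ {u v} → u ∈ U → v ∈ U → Touches T u → ¬ Touches T v → Near G u v
      touched~untouched {u} {v} u∈ v∈ tu v≁T with adj? G u v
      ... | yes u~v = inj₂ u~v
      ... | no u≁v = ⊥-elim (maximal u∈ (tu , lose v∈ (v≁T , u≁v)))
      handle : Dec (Touches T x) → Dec (Touches T y) → SomeCone
      handle (yes tx) (yes ty) = cone-over-connected conn tx ty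
        (λ { t∈ (inj₁ refl) → U∌T r∈ t∈ ; t∈ (inj₂ r~t) → r≁T (lose t∈ r~t) }) r~x r~y x≁y
      handle (yes tx) (no ¬ty) =
        ⊥-elim (x≁y (touched~untouched (inU x∈ r~x) (inU y∈ r~y) tx ¬ty))
      handle (no ¬tx) (yes ty) =
        ⊥-elim (x≁y (near-sym G (touched~untouched (inU y∈ r~y) (inU x∈ r~x) ty ¬tx)))
      handle (no ¬tx) (no ¬ty) = ⊥-elim (x≁y (simplicial
        (∈-filter⁺ (λ x → ¬? (touches? T x)) (inU x∈ r~x) ¬tx)
        (∈-filter⁺ (λ x → ¬? (touches? T x)) (inU y∈ r~y) ¬ty) r~x r~y))

  -- Dirac's theorem on chordal graphs, with a hole as the alternative outcome. A vertex `v` that is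
  -- not near some `w` starts the growth at `T = v ∷ []`, leaving `w` untouched; since `v` itself is
  -- left out of `U`, the inductive call is on a smaller set.
  simplicial-or-cone : ∀ k S → length S ≤ k → ∃[ r ] r ∈ S → Outcome S
  simplicial-or-cone zero [] _ (_ , ())
  simplicial-or-cone (suc k) S S≤k (r , r∈) with search (λ v → any? (λ w → ¬? (near? G v w)) S) S
  ... | inj₂ clique = inj₁ (r , r∈ , λ {x} {y} x∈ y∈ _ _ → near x∈ y∈)
    where
    near : ∀ {x y} → x ∈ S → y ∈ S → Near G x y
    near {x} {y} x∈ y∈ with near? G x y
    ... | yes p = p
    ... | no ¬p = ⊥-elim (clique x∈ (lose y∈ ¬p))
  ... | inj₁ (v , v∈ , someW) with find someW
  ...   | w , w∈ , v≁w = grow (simplicial-or-cone k) k (v ∷ []) (S ∖ v) U≤k U≤k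
      (connected-singleton v) cover (proj₁ ∘ ∈-remove⁻)
      (λ { z∈ (here z≡v) → proj₂ (∈-remove⁻ {xs = S} z∈) z≡v })
      (w , ∈-remove⁺ w∈ (λ w≡v → v≁w (inj₁ (≡.sym w≡v))) ,
       λ { (here w~v) → v≁w (inj₂ (adj-sym G w~v)) })
    where
    U≤k = ≤-pred (≤-trans (length-remove v∈) S≤k)
    cover : ∀ {z} → z ∈ S → z ∈ v ∷ [] ⊎ z ∈ S ∖ v
    cover {z} z∈ with z Fin.≟ v
    ... | yes z≡v = inj₁ (here z≡v)
    ... | no z≢v = inj₂ (∈-remove⁺ z∈ z≢v)

-- Greedy colouring and immersions

covers-<⇒≤length : ∀ k xs → (∀ {x} → x < k → x ∈ xs) → k ≤ length xs
covers-<⇒≤length zero xs _ = z≤n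
covers-<⇒≤length (suc k) xs ⊆xs = ≤-trans (s≤s (covers-<⇒≤length k (filter ≢k? xs)
    λ x<k → ∈-filter⁺ ≢k? (⊆xs (m<n⇒m<1+n x<k)) (<⇒≢ x<k)))
  (filter-notAll ≢k? xs (Any.map (λ { refl k≢k → k≢k refl }) (⊆xs (n<1+n k))))
  where
  ≢k? : Decidable (_≢ k)
  ≢k? x = ¬? (x ≟ k)

unused : ∀ k xs → length xs < k → ∃[ x ] x < k × x ∉ xs
unused k xs short with least (λ x → ¬? (x ∈? xs)) k
... | inj₂ (x , x<k , x∉ , _) = x , x<k , x∉
... | inj₁ none = ⊥-elim (<-irrefl refl (<-≤-trans short (covers-<⇒≤length k xs λ {x} x<k → mem x x<k)))
  where
  mem : ∀ x → x < k → x ∈ xs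
  mem x x<k with x ∈? xs
  ... | yes x∈ = x∈
  ... | no x∉ = ⊥-elim (none x x<k x∉)

unique⇒allPairs : ∀ {A : Set} {R : A → A → Set} {xs} → Unique xs →
  (∀ {x y} → x ∈ xs → y ∈ xs → x ≢ y → R x y) → AllPairs R xs
unique⇒allPairs [] _ = []
unique⇒allPairs (x≢ ∷ uniq) rel =
  All.tabulate (λ y∈ → rel (here refl) (there y∈) (All.lookup x≢ y∈)) ∷
  unique⇒allPairs uniq (λ x∈ y∈ → rel (there x∈) (there y∈))

allPairs-lookup : ∀ {A : Set} {R : A → A → Set} {xs} → AllPairs R xs →
  ∀ (i j : Fin (length xs)) → toℕ i < toℕ j → R (lookup xs i) (lookup xs j)
allPairs-lookup (r ∷ _) zero (suc j) _ = All.lookup r (∈-lookup j)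
allPairs-lookup (_ ∷ rs) (suc i) (suc j) (s≤s i<j) = allPairs-lookup rs i j i<j

module _ {n : ℕ} (G : Graph n) where

  -- `L` lists the branch vertices, and `D u v` is evidence for a detour from `u` to `v`. Two direct
  -- edges meet only if they join the same pair; `route-leaves` separates detours from direct edges,
  -- and `route-ends` separates detours from each other.
  module _ {L : List (Fin n)} (uniq : Unique L)
    {D : Fin n → Fin n → Set} (route : ∀ {u v} → D u v → List (Fin n))
    (route-path : ∀ {u v} (d : D u v) → IsPath G u v (route d))
    (route-avoids : ∀ {u v w} (d : D u v) → w ∈ L → w ∉ interior (route d))
    (route-leaves : ∀ {u v x y} (d : D u v) → UsesEdge x y (route d) → ¬ (x ∈ L × y ∈ L))
    (route-ends : ∀ {u v u′ v′ x y} (d : D u v) (d′ : D u′ v′) →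
      UsesEdge x y (route d) → UsesEdge x y (route d′) → u ≡ u′ × v ≡ v′)
    where

    link : ∀ {u v} → Adj G u v ⊎ D u v → List (Fin n)
    link {u} {v} (inj₁ _) = u ∷ v ∷ []
    link (inj₂ d) = route d

    link-path : ∀ {u v} (l : Adj G u v ⊎ D u v) → IsPath G u v (link l)
    link-path (inj₁ e) = step e (single _) , (adj⇒≢ G e ∷ []) ∷ [] ∷ []
    link-path (inj₂ d) = route-path d

    link-avoids : ∀ {u v w} (l : Adj G u v ⊎ D u v) → w ∈ L → w ∉ interior (link l)
    link-avoids (inj₁ _) _ ()
    link-avoids (inj₂ d) = route-avoids d

    SamePair : (u v u′ v′ : Fin n) → Set
    SamePair u v u′ v′ = (u ≡ u′ × v ≡ v′) ⊎ (u ≡ v′ × v ≡ u′)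

    usesEdge-pair : ∀ {x y u v : Fin n} → UsesEdge x y (u ∷ v ∷ []) → SamePair x y u v
    usesEdge-pair here-fw = inj₁ (refl , refl)
    usesEdge-pair here-bw = inj₂ (refl , refl)
    usesEdge-pair (there (there ()))

    both∈L : ∀ {x y u v} → u ∈ L → v ∈ L → SamePair x y u v → x ∈ L × y ∈ L
    both∈L u∈ v∈ (inj₁ (refl , refl)) = u∈ , v∈
    both∈L u∈ v∈ (inj₂ (refl , refl)) = v∈ , u∈

    combine : ∀ {x y u v u′ v′} → SamePair x y u v → SamePair x y u′ v′ → SamePair u v u′ v′
    combine (inj₁ (refl , refl)) s = s
    combine (inj₂ (refl , refl)) (inj₁ (p , q)) = inj₂ (q , p)
    combine (inj₂ (refl , refl)) (inj₂ (p , q)) = inj₁ (q , p)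

    link-samePair : ∀ {u v u′ v′ x y} → u ∈ L → v ∈ L → u′ ∈ L → v′ ∈ L →
      (l : Adj G u v ⊎ D u v) (l′ : Adj G u′ v′ ⊎ D u′ v′) →
      UsesEdge x y (link l) → UsesEdge x y (link l′) → SamePair u v u′ v′
    link-samePair _ _ _ _ (inj₁ _) (inj₁ _) e e′ = combine (usesEdge-pair e) (usesEdge-pair e′)
    link-samePair u∈ v∈ _ _ (inj₁ _) (inj₂ d′) e e′ =
      ⊥-elim (route-leaves d′ e′ (both∈L u∈ v∈ (usesEdge-pair e)))
    link-samePair _ _ u∈ v∈ (inj₂ d) (inj₁ _) e e′ =
      ⊥-elim (route-leaves d e (both∈L u∈ v∈ (usesEdge-pair e′)))
    link-samePair _ _ _ _ (inj₂ d) (inj₂ d′) e e′ = inj₁ (route-ends d d′ e e′)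

    immersion : AllPairs (λ u v → Adj G u v ⊎ D u v) L → ImmersesComplete G (length L)
    immersion linked = lookup L , lookup-injective , (λ i j p → link (linkOf i j p)) ,
      (λ i j p → link-path (linkOf i j p)) , disjoint ,
      λ i j p k → link-avoids (linkOf i j p) (∈-lookup k)
      where
      linkOf = allPairs-lookup linked
      lookup-injective : ∀ {i j} → lookup L i ≡ lookup L j → i ≡ j
      lookup-injective {i} {j} e with <-cmp (toℕ i) (toℕ j)
      ... | tri< i<j _ _ = ⊥-elim (allPairs-lookup uniq i j i<j e)
      ... | tri≈ _ i≡j _ = Fin.toℕ-injective i≡j
      ... | tri> _ _ j<i = ⊥-elim (allPairs-lookup uniq j i j<i (≡.sym e))
      disjoint : ∀ i j p i′ j′ p′ → ¬ (i ≡ i′ × j ≡ j′) →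
        EdgeDisjoint (link (linkOf i j p)) (link (linkOf i′ j′ p′))
      disjoint i j p i′ j′ p′ distinct x y e e′
        with link-samePair (∈-lookup i) (∈-lookup j) (∈-lookup i′) (∈-lookup j′)
               (linkOf i j p) (linkOf i′ j′ p′) e e′
      ... | inj₁ (q , r) = distinct (lookup-injective q , lookup-injective r)
      ... | inj₂ (q , r) with lookup-injective {i} {j′} q | lookup-injective {j} {i′} r
      ...   | refl | refl = <-asym p p′

  clique-immersion : ∀ {K m} → AllPairs (Adj G) K → m ≤ length K → ImmersesComplete G m
  clique-immersion {K} {m} clique m≤ =
    subst (ImmersesComplete G) (trans (length-take m K) (m≤n⇒m⊓n≡m m≤))
      (immersion (AllPairs.map (adj⇒≢ G) clique′) {D = λ _ _ → ⊥} (λ ()) (λ ()) (λ ()) (λ ()) (λ ())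
        (AllPairs.map inj₁ clique′))
    where
    clique′ = AllPairs.take⁺ m clique

  -- Colours are natural numbers, bounded on `S` only: a map into `Fin k` on all vertices would not
  -- exist for `k = 0`, where the empty `S` must still be colourable.
  ColourableOn : List (Fin n) → ℕ → Set
  ColourableOn S k = Σ (Fin n → ℕ) λ c → (∀ {v} → v ∈ S → c v < k) ×
    (∀ {u v} → u ∈ S → v ∈ S → Adj G u v → c u ≢ c v)

  Clique> : ℕ → Set
  Clique> k = ∃[ K ] AllPairs (Adj G) K × k < length K

  extend-colouring : ∀ {S v k} → v ∈ S → ColourableOn (S ∖ v) k →
    length (filter (adj? G v) S) < k → ColourableOn S k
  extend-colouring {S} {v} {k} v∈ (c , c< , proper) few
    with unused k (map c (filter (adj? G v) S)) (subst (_< k) (≡.sym (length-map c (filter (adj? G v) S))) few)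
  ... | new , new<k , new∉ = c′ , c′< , proper′
    where
    c′ : Fin n → ℕ
    c′ u with u Fin.≟ v
    ... | yes _ = new
    ... | no _ = c u
    c′< : ∀ {u} → u ∈ S → c′ u < k
    c′< {u} u∈ with u Fin.≟ v
    ... | yes _ = new<k
    ... | no u≢v = c< (∈-remove⁺ u∈ u≢v)
    fresh : ∀ {u} → u ∈ S → Adj G v u → c u ≢ new
    fresh u∈ v~u refl = new∉ (∈-map⁺ c (∈-filter⁺ (adj? G v) u∈ v~u))
    proper′ : ∀ {x y} → x ∈ S → y ∈ S → Adj G x y → c′ x ≢ c′ y
    proper′ {x} {y} x∈ y∈ x~y with x Fin.≟ v | y Fin.≟ v
    ... | yes refl | yes refl = λ _ → adj⇒≢ G x~y refl
    ... | yes refl | no _ = fresh y∈ x~y ∘ ≡.sym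
    ... | no _ | yes refl = fresh x∈ (adj-sym G x~y)
    ... | no x≢v | no y≢v = proper (∈-remove⁺ x∈ x≢v) (∈-remove⁺ y∈ y≢v) x~y

  -- The neighbours of a simplicial `v` form a clique. Fewer than `k` of them leave a colour for
  -- `v`; otherwise they and `v` are a clique of more than `k` vertices.
  eliminate : ∀ k f S → length S ≤ f → Unique S → (ColourableOn S k ⊎ Clique> k) ⊎ SomeCone G
  eliminate k f [] _ _ = inj₁ (inj₁ ((λ _ → 0) , (λ ()) , λ ()))
  eliminate k (suc f) S@(s ∷ _) S≤f uniq with simplicial-or-cone G _ S ≤-refl (s , here refl)
  ... | inj₂ cone = inj₂ cone
  ... | inj₁ (v , v∈ , simplicial)
    with eliminate k f (S ∖ v) (≤-pred (≤-trans (length-remove v∈) S≤f)) (Unique.filter⁺ (λ x → ¬? (x Fin.≟ v)) uniq)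
  ...   | inj₂ cone = inj₂ cone
  ...   | inj₁ (inj₂ clique) = inj₁ (inj₂ clique)
  ...   | inj₁ (inj₁ colouring) with length (filter (adj? G v) S) <? k
  ...     | yes few = inj₁ (inj₁ (extend-colouring v∈ colouring few))
  ...     | no many = inj₁ (inj₂ (v ∷ filter (adj? G v) S ,
              All.tabulate (proj₂ ∘ mem) ∷ unique⇒allPairs (Unique.filter⁺ (adj? G v) uniq)
                (λ x∈ y∈ x≢y → near⇒adj G x≢y
                  (simplicial (proj₁ (mem x∈)) (proj₁ (mem y∈)) (proj₂ (mem x∈)) (proj₂ (mem y∈)))) ,
              s≤s (≮⇒≥ many)))
    where
    mem : ∀ {x} → x ∈ filter (adj? G v) S → x ∈ S × Adj G v x
    mem = ∈-filter⁻ (adj? G v)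

-- The structure around a hole

%-distinct : ∀ m .{{_ : NonZero m}} {x y} → x < y → y < m + x → x % m ≢ y % m
%-distinct m {x} {y} x<y y<m+x eq = <-irrefl refl (<-≤-trans y<m+x (begin
  m + x                        ≡⟨ cong (m +_) (m≡m%n+[m/n]*n x m) ⟩
  m + (x % m + x / m * m)      ≡⟨ trans (≡.sym (+-assoc m (x % m) _)) (trans (cong (_+ x / m * m) (+-comm m (x % m))) (+-assoc (x % m) m _)) ⟩
  x % m + suc (x / m) * m      ≤⟨ +-monoʳ-≤ (x % m) (*-monoˡ-≤ m quotient<) ⟩
  x % m + y / m * m            ≡⟨ cong (_+ y / m * m) eq ⟩
  y % m + y / m * m            ≡⟨ m≡m%n+[m/n]*n y m ⟨
  y                            ∎))
  where
  open ≤-Reasoning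
  quotient< : x / m < y / m
  quotient< = ≰⇒> λ y/m≤ → <⇒≱ x<y (begin
    y                  ≡⟨ m≡m%n+[m/n]*n y m ⟩
    y % m + y / m * m  ≤⟨ +-monoʳ-≤ (y % m) (*-monoˡ-≤ m y/m≤) ⟩
    y % m + x / m * m  ≡⟨ cong (_+ x / m * m) eq ⟨
    x % m + x / m * m  ≡⟨ m≡m%n+[m/n]*n x m ⟨
    x                  ∎)

-- Periodic indexing by ℕ lets each condition cover the wrap-around as well. `A-apart` stops before
-- distance `2 * a`, because `A (2 * a + i)` is the class preceding `A i`.
record CycleBlowup {n} (G : Graph n) (a : ℕ) : Set where
  field
    A          : ℕ → List (Fin n)
    B          : List (Fin n)
    cyclic     : ∀ i → A (suc (2 * a) + i) ≡ A i
    A-unique   : ∀ i → Unique (A i)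
    B-unique   : Unique B
    A-disjoint : ∀ {v} e i → 0 < e → e ≤ 2 * a → v ∈ A i → v ∉ A (e + i)
    B-clique   : ∀ {u v} → u ∈ B → v ∈ B → u ≢ v → Adj G u v
    B-A        : ∀ {u v} i → u ∈ B → v ∈ A i → Adj G u v
    A-clique   : ∀ {u v} i → u ∈ A i → v ∈ A i → u ≢ v → Adj G u v
    A-next     : ∀ {u v} i → u ∈ A i → v ∈ A (suc i) → Adj G u v
    A-apart    : ∀ {u v} e i → 2 ≤ e → e < 2 * a → u ∈ A i → v ∈ A (e + i) → ¬ Adj G u v

  Spanning : Set
  Spanning = ∀ v → v ∈ B ⊎ (∃[ i ] i ≤ 2 * a × v ∈ A i)

module HoleStructure {n : ℕ} (G : Graph n) (a : ℕ) (2≤a : 2 ≤ a)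
  (bounded : ∀ S → IsIndependent G S → length S ≤ a)
  (holeless : ∀ ℓ → 4 ≤ ℓ → ℓ ≤ 2 * a → ¬ HasInducedCycle G ℓ) (H : Hole G a) where

  open Hole H
  open WithoutShortHoles G a bounded holeless

  m : ℕ
  m = suc (2 * a)

  4≤2a : 4 ≤ 2 * a
  4≤2a = *-monoʳ-≤ 2 2≤a

  c-multiple : ∀ q t → c (q * m + t) ≡ c t
  c-multiple zero t = refl
  c-multiple (suc q) t = trans (cong c (+-assoc m (q * m) t)) (trans (periodic (q * m + t)) (c-multiple q t))

  c-% : ∀ d t → c (d + t) ≡ c (d + t % m)
  c-% d t = trans (cong c eq) (c-multiple (t / m) (d + t % m))
    where
    eq : d + t ≡ t / m * m + (d + t % m)
    eq = trans (cong (d +_) (m≡m%n+[m/n]*n t m)) (trans (≡.sym (+-assoc d _ _)) (+-comm (d + t % m) _))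

  hole-cone : ∀ {v} p L → 2 ≤ L → L < 2 * a → Adj G v (c p) → Adj G v (c (L + p)) →
    (∀ i → 0 < i → i < L → ¬ Near G v (c (i + p))) → Cone G L (λ i → c (i + p)) v
  hole-cone p L 2≤L L<2a first last inner = record
    { path = record
      { next = λ i _ → next (i + p)
      ; far = λ i j 2+i≤j j≤L → far (i + p) (j + p) (+-monoˡ-≤ p 2+i≤j)
          (<-≤-trans (+-monoˡ-< p (≤-<-trans j≤L L<2a)) (+-monoʳ-≤ (2 * a) (m≤n+m p i)))
      }
    ; 2≤L = 2≤L ; first = first ; last = last ; inner = inner }

  -- The gap and `v` would form an induced cycle of length `2 + L`. `Near` at the ends can be
  -- sharpened to adjacency: were `v` an end of the stretch, it would see the inner vertex beside
  -- that end.
  no-gap : ∀ {v} p L → 2 ≤ L → 2 + L ≤ 2 * a → Near G v (c p) → Near G v (c (L + p)) →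
    ¬ (∀ i → 0 < i → i < L → ¬ Near G v (c (i + p)))
  no-gap p (suc L) 2≤1+L short first last inner =
    no-short-cone
      (hole-cone p (suc L) 2≤1+L (≤-trans (n≤1+n _) short)
        (near⇒adj G (λ { refl → inner 1 z<s 2≤1+L (inj₂ (next p)) }) first)
        (near⇒adj G (λ { refl → inner L (≤-pred 2≤1+L) (n<1+n L) (inj₂ (adj-sym G (next (L + p)))) }) last)
        inner)
      short

  -- Otherwise v and every second one of 2 a − 1 consecutive hole vertices are independent.
  not-undominated : ∀ {v} s → ¬ (∀ j → j < a → ¬ Near G v (c (2 * j + s)))
  not-undominated {v} s none = <-irrefl refl (independent-≤ f (suc a) apart)
    where
    f : ℕ → Fin n
    f zero = v
    f (suc j) = c (2 * j + s)
    apart : ∀ i j → i < j → j < suc a → ¬ Near G (f i) (f j)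
    apart zero (suc j) _ j<a = none j (≤-pred j<a)
    apart (suc i) (suc j) i<j j<a = far (2 * i + s) (2 * j + s)
      (+-monoˡ-≤ s (2+2i≤2j (≤-pred i<j)))
      (<-≤-trans (+-monoˡ-< s (*-monoʳ-< 2 (≤-pred j<a))) (+-monoʳ-≤ (2 * a) (m≤n+m s (2 * i))))

  -- Adjacency of v and c (1 + i) is left open, so that c (1 + i) itself is an instance of v.
  record Triple (v : Fin n) (i : ℕ) : Set where
    field
      left  : Adj G v (c i)
      right : Adj G v (c (2 + i))
      apart : ∀ d → 3 ≤ d → d ≤ 2 * a → ¬ Near G v (c (d + i))

  triple-cong : ∀ {v i j} → (∀ d → c (d + i) ≡ c (d + j)) → Triple v i → Triple v j
  triple-cong eq t = record
    { left = subst (Adj G _) (eq 0) left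
    ; right = subst (Adj G _) (eq 2) right
    ; apart = λ d 3≤d d≤ → subst (¬_ ∘ Near G _) (eq d) (apart d 3≤d d≤)
    }
    where open Triple t

  -- By `no-gap`, the next near position after `p` is not among the first `2 * a − 2`. If the one
  -- after those, `q`, is not near either, every second vertex in between makes an independent set
  -- with `v`. So `q` is near, two steps before `p` comes round again, and the position between them
  -- is near since otherwise a 4-cycle arises.
  gap⇒triple : ∀ {v} p → Near G v (c p) → ¬ Near G v (c (suc p)) → ∃[ i ] Triple v i
  gap⇒triple {v} p near-p far-1+p = from-search (least (λ i → near? G v (c (2 + i + p))) (suc e))
    where
    -- With this `e` one turn consists of `p`, the gap `p + 1`, ..., `p + 2 + e`, then
    -- `q = p + 3 + e` and `q + 1`; `q + 2` is `p` again.
    e = 2 * a ∸ 4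
    2a≡4+e : 2 * a ≡ 4 + e
    2a≡4+e = ≡.sym (m+[n∸m]≡n 4≤2a)

    around : c (5 + e + p) ≡ c p
    around = trans (cong (λ k → c (suc k + p)) (≡.sym 2a≡4+e)) (periodic p)

    at-q : (∀ o → 1 ≤ o → o ≤ 2 + e → ¬ Near G v (c (o + p))) → Dec (Near G v (c (3 + e + p))) →
      Dec (Near G v (c (4 + e + p))) → ∃[ i ] Triple v i
    at-q none (no far-q) _ = ⊥-elim (not-undominated (suc p) λ j j<a →
        subst (¬_ ∘ Near G v ∘ c) (≡.sym (+-suc (2 * j) p)) (none′ (suc (2 * j)) (s≤s z≤n)
          (≤-pred (subst (2 + 2 * j ≤_) 2a≡4+e (2+2i≤2j j<a)))))
      where
      none′ : ∀ o → 1 ≤ o → o ≤ 3 + e → ¬ Near G v (c (o + p))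
      none′ o 1≤o o≤ with m≤n⇒m<n∨m≡n o≤
      ... | inj₁ o< = none o 1≤o (≤-pred o<)
      ... | inj₂ refl = far-q
    at-q none (yes near-q) (no far-1+q) = ⊥-elim (no-gap (3 + e + p) 2 ≤-refl 4≤2a near-q
      (subst (Near G v) (≡.sym around) near-p) λ { (suc zero) _ _ → far-1+q ; (suc (suc _)) _ (s≤s (s≤s ())) })
    at-q none (yes near-q) (yes near-1+q) = 3 + e + p , record
      { left = near⇒adj G (λ { refl → none (2 + e) (s≤s z≤n) ≤-refl (inj₂ (adj-sym G (next (2 + e + p)))) }) near-q
      ; right = subst (Adj G v) (≡.sym around) (near⇒adj G (λ { refl → far-1+p (inj₂ (next p)) }) near-p)
      ; apart = λ { (suc (suc d)) (s≤s (s≤s 1≤d)) d≤ → subst (¬_ ∘ Near G v) (≡.sym (turn d))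
                      (none d 1≤d (≤-pred (≤-pred (subst (2 + d ≤_) 2a≡4+e d≤)))) }
      }
      where
      turn : ∀ d → c (2 + d + (3 + e + p)) ≡ c (d + p)
      turn d = trans (cong c (trans (cong (2 +_) (trans (≡.sym (+-assoc d (3 + e) p))
          (trans (cong (_+ p) (+-comm d (3 + e))) (+-assoc (3 + e) d p))))
          (cong (λ k → suc k + (d + p)) (≡.sym 2a≡4+e))))
        (periodic (d + p))

    from-search : _ → ∃[ i ] Triple v i
    from-search (inj₂ (i , i<1+e , near , min)) = ⊥-elim (no-gap p (2 + i) (s≤s (s≤s z≤n))
      (subst (4 + i ≤_) (≡.sym 2a≡4+e) (+-monoʳ-≤ 4 (≤-pred i<1+e))) near-p near
      λ { (suc zero) _ _ → far-1+p ; (suc (suc k)) _ k< → min k (≤-pred (≤-pred k<)) })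
    from-search (inj₁ none) = at-q
      (λ { (suc zero) _ _ → far-1+p ; (suc (suc o)) _ o≤ → none o (≤-pred o≤) })
      (near? G v _) (near? G v _)

  Complete : Fin n → Set
  Complete v = ∀ i → Adj G v (c i)

  -- From a position that is not near `v`, `not-undominated` leads to a near one, and within one
  -- turn nearness ends again. The last near position before that is where `gap⇒triple` applies.
  complete-or-triple : ∀ v → Complete v ⊎ ∃[ i ] Triple v i
  complete-or-triple v with least (λ i → ¬? (near? G v (c i))) m
  ... | inj₁ all-near = inj₁ λ i → near⇒adj G
          (λ { refl → far i (2 + i) ≤-refl (+-monoˡ-≤ i (≤-trans (n≤1+n 3) 4≤2a)) (near (2 + i)) }) (near i)
    where
    near : ∀ i → Near G v (c i)
    near i with near? G v (c (i % m))
    ... | yes p = subst (Near G v) (≡.sym (c-% 0 i)) p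
    ... | no ¬p = ⊥-elim (all-near (i % m) (m%n<n i m) ¬p)
  ... | inj₂ (p , _ , far-p , _) with least (λ i → near? G v (c (i + p))) m
  ...   | inj₁ none = ⊥-elim (not-undominated p λ j j<a → none (2 * j) (m<n⇒m<1+n (*-monoʳ-< 2 j<a)))
  ...   | inj₂ (zero , _ , near-p , _) = ⊥-elim (far-p near-p)
  ...   | inj₂ (suc j , 1+j<m , near-q , _) with least (λ i → ¬? (near? G v (c (i + (suc j + p))))) m
  ...     | inj₁ all-near = ⊥-elim (all-near (m ∸ suc j) (s≤s (m∸n≤m (2 * a) j)) far-around)
    where
    far-around : ¬ Near G v (c (m ∸ suc j + (suc j + p)))
    far-around = far-p ∘ subst (Near G v) (trans (cong c (trans (≡.sym (+-assoc (m ∸ suc j) (suc j) p))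
      (cong (_+ p) (m∸n+n≡m (<⇒≤ 1+j<m))))) (periodic p))
  ...     | inj₂ (zero , _ , far-q , _) = inj₂ (⊥-elim (far-q near-q))
  ...     | inj₂ (suc i , _ , far-1+i , min) with near? G v (c (i + (suc j + p)))
  ...       | yes near-i = inj₂ (gap⇒triple _ near-i far-1+i)
  ...       | no far-i = ⊥-elim (min i (n<1+n i) far-i)

  -- Otherwise `u`, `c i`, `v`, `c (2 + i)` is an induced 4-cycle. This square is behind all the
  -- cliques of the structure and the join to `B`.
  common-neighbours : ∀ {u v} i → u ≢ v → Adj G u (c i) → Adj G u (c (2 + i)) →
    Adj G v (c i) → Adj G v (c (2 + i)) → Adj G u v
  common-neighbours {u} {v} i u≢v u~c u~c₂ v~c v~c₂ with adj? G u v
  ... | yes u~v = u~v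
  ... | no u≁v = ⊥-elim (no-short-cone cone 4≤2a)
    where
    P : ℕ → Fin n
    P zero = c i
    P (suc zero) = v
    P (suc (suc _)) = c (2 + i)
    cone : Cone G 2 P u
    cone = record
      { path = record
        { next = λ { zero _ → adj-sym G v~c ; (suc zero) _ → v~c₂ ; (suc (suc _)) (s≤s (s≤s ())) }
        ; far = λ { zero (suc (suc _)) _ _ → far i (2 + i) ≤-refl (+-monoˡ-≤ i (≤-trans (n≤1+n 3) 4≤2a))
                  ; zero (suc zero) (s≤s ()) _
                  ; (suc i) j 3+i≤j j≤2 → ⊥-elim (m+n≮m 2 i (≤-trans 3+i≤j j≤2)) } }
      ; 2≤L = ≤-refl ; first = u~c ; last = u~c₂
      ; inner = λ { (suc zero) _ _ → λ { (inj₁ u≡v) → u≢v u≡v ; (inj₂ u~v) → u≁v u~v }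
                  ; (suc (suc _)) _ (s≤s (s≤s ())) } }

  complete-clique : ∀ {u v} → Complete u → Complete v → u ≢ v → Adj G u v
  complete-clique u v u≢v = common-neighbours 0 u≢v (u 0) (u 2) (v 0) (v 2)

  complete-triple : ∀ {u v i} → Complete u → Triple v i → Adj G u v
  complete-triple {i = i} u t = common-neighbours i
    (λ { refl → Triple.apart t 3 ≤-refl (≤-trans (n≤1+n 3) 4≤2a) (inj₂ (u (3 + i))) })
    (u i) (u (2 + i)) (Triple.left t) (Triple.right t)

  triple-clique : ∀ {u v i} → Triple u i → Triple v i → u ≢ v → Adj G u v
  triple-clique s t u≢v =
    common-neighbours _ u≢v (Triple.left s) (Triple.right s) (Triple.left t) (Triple.right t)

  -- If not, `u` and `v` together with the `a − 1` hole vertices `c (4 + i)`, `c (6 + i)`, ...,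
  -- `c (2 * a + i)` form an independent set of size `a + 1`.
  triple-next : ∀ {u v i} → Triple u i → Triple v (suc i) → Adj G u v
  triple-next {u} {v} {i} s t with near? G u v
  ... | yes near = near⇒adj G (λ { refl → Triple.apart s 3 ≤-refl (≤-trans (n≤1+n 3) 4≤2a) (inj₂ (Triple.right t)) }) near
  ... | no far-uv = ⊥-elim (<-irrefl refl (independent-≤ f (suc a) apart))
    where
    f : ℕ → Fin n
    f zero = u
    f (suc zero) = v
    f (suc (suc j)) = c (2 * (2 + j) + i)
    4≤ : ∀ j → 4 ≤ 2 * (2 + j)
    4≤ j = *-monoʳ-≤ 2 (s≤s (s≤s z≤n))
    ≤2a : ∀ {j} → 2 + j < suc a → 2 * (2 + j) ≤ 2 * a
    ≤2a j< = *-monoʳ-≤ 2 (≤-pred j<)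
    apart : ∀ i j → i < j → j < suc a → ¬ Near G (f i) (f j)
    apart zero (suc zero) _ _ = far-uv
    apart zero (suc (suc j)) _ j< = Triple.apart s (2 * (2 + j)) (≤-trans (n≤1+n 3) (4≤ j)) (≤2a j<)
    apart (suc zero) (suc zero) (s≤s ()) _
    apart (suc zero) (suc (suc j)) _ j< = subst (¬_ ∘ Near G v ∘ c) (+-suc _ i)
      (Triple.apart t (pred (2 * (2 + j))) (≤-pred (4≤ j)) (≤-trans pred[n]≤n (≤2a j<)))
    apart (suc (suc x)) (suc zero) (s≤s ()) _
    apart (suc (suc x)) (suc (suc y)) x<y y< = far (2 * (2 + x) + i) (2 * (2 + y) + i)
      (+-monoˡ-≤ i (2+2i≤2j x<y))
      (≤-<-trans (+-monoˡ-≤ i (≤2a y<)) (+-monoʳ-< (2 * a) (m<n+m i (≤-trans (s≤s z≤n) (4≤ x)))))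

  -- An edge between `u` and `v` would close the path `u`, `c (2 + i)`, ..., `c (e + i)`, `v` to an
  -- induced cycle of length `e + 1`, which is at least 4 and at most `2 * a`.
  triple-apart₃ : ∀ {u v} e i → 3 ≤ e → e < 2 * a → Triple u i → Triple v (e + i) → ¬ Adj G u v
  triple-apart₃ {u} {v} (suc (suc e)) i (s≤s (s≤s 1≤e)) e<2a s t u~v =
    no-short-cone cone e<2a
    where
    P : ℕ → Fin n
    P zero = u
    P (suc x) = c (2 + x + i)
    -- `Triple.apart` counts forward from the index of `v`, so a vertex `k` steps behind it is
    -- reached as `m − k` steps ahead.
    far-v : ∀ x → x < e → ¬ Near G v (c (2 + x + i))
    far-v x x<e = subst (¬_ ∘ Near G v) (trans (cong c eq) (periodic (2 + x + i)))
        (Triple.apart t d 3≤d d≤2a)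
      where
      k = e ∸ x
      d = m ∸ k
      k≤e : k ≤ e
      k≤e = m∸n≤m e x
      k≤m : k ≤ m
      k≤m = ≤-trans k≤e (≤-trans (m≤n+m e 3) (m≤n⇒m≤1+n e<2a))
      1≤k : 1 ≤ k
      1≤k = m<n⇒0<n∸m x<e
      d≤2a : d ≤ 2 * a
      d≤2a = ∸-monoʳ-≤ m 1≤k
      3≤d : 3 ≤ d
      3≤d = m+n≤o⇒m≤o∸n 3 (≤-trans (+-monoʳ-≤ 3 k≤e) (m≤n⇒m≤1+n e<2a))
      eq : d + (2 + e + i) ≡ m + (2 + x + i)
      eq = begin
        d + (2 + e + i)        ≡⟨ cong (λ z → d + (2 + z + i)) (m∸n+n≡m (<⇒≤ x<e)) ⟨
        d + (2 + (k + x) + i)  ≡⟨ cong (d +_) (trans (cong (2 +_) (+-assoc k x i)) (trans (cong suc (≡.sym (+-suc k _))) (≡.sym (+-suc k _)))) ⟩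
        d + (k + (2 + x + i))  ≡⟨ +-assoc d k _ ⟨
        d + k + (2 + x + i)    ≡⟨ cong (_+ (2 + x + i)) (m∸n+n≡m k≤m) ⟩
        m + (2 + x + i)        ∎
        where open ≡-Reasoning
    cone : Cone G (suc e) P v
    cone = record
      { path = record
        { next = λ { zero _ → Triple.right s ; (suc x) _ → next (2 + x + i) }
        ; far = λ { zero (suc y) 1≤y y≤ → Triple.apart s (2 + y) (s≤s 1≤y) (≤-trans (s≤s y≤) (<⇒≤ e<2a))
                  ; (suc x) (suc y) 2+x≤y y≤ → far (2 + x + i) (2 + y + i) (s≤s (s≤s (+-monoˡ-≤ i (≤-pred 2+x≤y))))
                      (≤-<-trans (s≤s (+-monoˡ-≤ i y≤)) (<-≤-trans (+-monoˡ-< i e<2a) (+-monoʳ-≤ (2 * a) (m≤n+m i (2 + x))))) } }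
      ; 2≤L = s≤s 1≤e ; first = adj-sym G u~v ; last = Triple.left t
      ; inner = λ { (suc x) _ x< → far-v x (≤-pred x<) } }

  -- At distance 2 the short arc would give only a triangle, so this pair is measured the other way
  -- round the hole, where its distance is `2 * a − 1`.
  triple-apart : ∀ {u v} e i → 2 ≤ e → e < 2 * a → Triple u i → Triple v (e + i) → ¬ Adj G u v
  triple-apart {u} {v} e i 2≤e e<2a s t u~v with m≤n⇒m<n∨m≡n 2≤e
  ... | inj₁ 3≤e = triple-apart₃ e i 3≤e e<2a s t u~v
  ... | inj₂ refl = triple-apart₃ (2 * a ∸ 1) (2 + i) (∸-monoˡ-≤ 1 4≤2a) (∸-monoʳ-< z<s (≤-trans (s≤s z≤n) 4≤2a)) t
          (triple-cong (λ d → trans (≡.sym (periodic (d + i))) (cong c (eq d))) s) (adj-sym G u~v)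
    where
    eq : ∀ d → m + (d + i) ≡ d + (2 * a ∸ 1 + (2 + i))
    eq d = begin
      m + (d + i) ≡⟨ trans (≡.sym (+-assoc m d i)) (trans (cong (_+ i) (+-comm m d)) (+-assoc d m i)) ⟩
      d + (suc (2 * a) + i) ≡⟨ cong (λ z → d + (suc z + i)) (m∸n+n≡m (≤-trans (s≤s z≤n) 4≤2a)) ⟨
      d + (suc (2 * a ∸ 1 + 1) + i) ≡⟨ cong (λ z → d + (z + i)) (+-suc (2 * a ∸ 1) 1) ⟨
      d + (2 * a ∸ 1 + 2 + i) ≡⟨ cong (d +_) (+-assoc (2 * a ∸ 1) 2 i) ⟩
      d + (2 * a ∸ 1 + (2 + i)) ∎
      where open ≡-Reasoning

  -- `nothing` stands for `B` and `just i` for `A i`. One value per vertex makes the classes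
  -- disjoint by construction, although the index of a triple comes from a search.
  classOf : ∀ {v} → Complete v ⊎ ∃[ i ] Triple v i → Maybe ℕ
  classOf (inj₁ _) = nothing
  classOf (inj₂ (i , _)) = just (i % m)

  class : Fin n → Maybe ℕ
  class v = classOf (complete-or-triple v)

  members : Maybe ℕ → List (Fin n)
  members k = filter (λ v → Maybe.≡-dec _≟_ (class v) k) (allFin n)

  ∈-members : ∀ v → v ∈ members (class v)
  ∈-members v = ∈-filter⁺ _ (∈-allFin v) refl

  members⇒class : ∀ {v} k → v ∈ members k → class v ≡ k
  members⇒class k v∈ = proj₂ (∈-filter⁻ _ {xs = allFin n} v∈)

  members⇒complete : ∀ {v} → v ∈ members nothing → Complete v
  members⇒complete {v} v∈ with complete-or-triple v | members⇒class nothing v∈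
  ... | inj₁ complete | _ = complete

  members⇒triple : ∀ {v} i → v ∈ members (just (i % m)) → Triple v i
  members⇒triple {v} i v∈ with complete-or-triple v | members⇒class (just (i % m)) v∈
  ... | inj₂ (j , t) | eq = triple-cong (λ d → trans (c-% d j)
          (trans (cong (λ k → c (d + k)) (Maybe.just-injective eq)) (≡.sym (c-% d i)))) t

  hole⇒blowup : CycleBlowup G a
  hole⇒blowup = record
    { A = λ i → members (just (i % m))
    ; B = members nothing
    ; cyclic = λ i → cong (members ∘ just) (trans (cong (_% m) (+-comm m i)) ([m+n]%n≡m%n i m))
    ; A-unique = λ i → Unique.filter⁺ _ (Unique.allFin⁺ n)
    ; B-unique = Unique.filter⁺ _ (Unique.allFin⁺ n)
    ; A-disjoint = λ e i 0<e e≤2a v∈ v∈′ → %-distinct m (m<n+m i 0<e) (+-monoˡ-< i (s≤s e≤2a))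
        (Maybe.just-injective (trans (≡.sym (members⇒class _ v∈)) (members⇒class _ v∈′)))
    ; B-clique = λ u∈ v∈ → complete-clique (members⇒complete u∈) (members⇒complete v∈)
    ; B-A = λ i u∈ v∈ → complete-triple (members⇒complete u∈) (members⇒triple i v∈)
    ; A-clique = λ i u∈ v∈ → triple-clique (members⇒triple i u∈) (members⇒triple i v∈)
    ; A-next = λ i u∈ v∈ → triple-next (members⇒triple i u∈) (members⇒triple (suc i) v∈)
    ; A-apart = λ e i 2≤e e< u∈ v∈ → triple-apart e i 2≤e e< (members⇒triple i u∈) (members⇒triple (e + i) v∈)
    }

  hole⇒blowup-spanning : CycleBlowup.Spanning hole⇒blowup
  hole⇒blowup-spanning = cover
    where
    class-< : ∀ {v i} → class v ≡ just i → i < m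
    class-< {v} eq with complete-or-triple v
    class-< refl | inj₂ (j , _) = m%n<n j m
    cover : ∀ v → v ∈ members nothing ⊎ (∃[ i ] i ≤ 2 * a × v ∈ members (just (i % m)))
    cover v with class v in eq
    ... | nothing = inj₁ (subst (λ k → v ∈ members k) eq (∈-members v))
    ... | just i = inj₂ (i , ≤-pred (class-< eq) ,
            subst (λ k → v ∈ members k) (trans eq (cong just (≡.sym (m<n⇒m%n≡m (class-< eq))))) (∈-members v))

-- Circular colouring of a blow-up

sum< : (ℕ → ℕ) → ℕ → ℕ
sum< f zero = 0
sum< f (suc k) = sum< f k + f k

sum<-+ : ∀ f p q → sum< f (p + q) ≡ sum< f p + sum< (λ i → f (p + i)) q
sum<-+ f p zero = trans (cong (sum< f) (+-identityʳ p)) (≡.sym (+-identityʳ _))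
sum<-+ f p (suc q) = trans (cong (sum< f) (+-suc p q))
  (trans (cong (_+ f (p + q)) (sum<-+ f p q)) (+-assoc (sum< f p) _ _))

sum<-shift : ∀ f m → f m ≡ f 0 → sum< (f ∘ suc) m ≡ sum< f m
sum<-shift f m fm≡f0 = +-cancelˡ-≡ (f 0) _ _ (begin
  f 0 + sum< (f ∘ suc) m ≡⟨ sum<-+ f 1 m ⟨
  sum< f m + f m         ≡⟨ cong (sum< f m +_) fm≡f0 ⟩
  sum< f m + f 0         ≡⟨ +-comm (sum< f m) (f 0) ⟩
  f 0 + sum< f m         ∎)
  where open ≡-Reasoning

sum<-pairs : ∀ {w} f → (∀ i → f i + f (suc i) ≤ w) → ∀ q → sum< f (q * 2) ≤ q * w
sum<-pairs f le zero = z≤n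
sum<-pairs {w} f le (suc q) = begin
  sum< f (q * 2) + f (q * 2) + f (suc (q * 2))   ≡⟨ +-assoc (sum< f (q * 2)) _ _ ⟩
  sum< f (q * 2) + (f (q * 2) + f (suc (q * 2))) ≤⟨ +-mono-≤ (sum<-pairs f le q) (le (q * 2)) ⟩
  q * w + w                                      ≡⟨ +-comm (q * w) w ⟩
  suc q * w                                      ∎
  where open ≤-Reasoning

sum<-∸ : ∀ {w} f m → (∀ i → f i ≤ w) → sum< (λ i → w ∸ f i) m + sum< f m ≡ m * w
sum<-∸ f zero f≤w = refl
sum<-∸ {w} f (suc m) f≤w = begin
  S + (w ∸ f m) + (F + f m)   ≡⟨ +-assoc S _ _ ⟩
  S + ((w ∸ f m) + (F + f m)) ≡⟨ cong (λ x → S + ((w ∸ f m) + x)) (+-comm F (f m)) ⟩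
  S + ((w ∸ f m) + (f m + F)) ≡⟨ cong (S +_) (+-assoc (w ∸ f m) _ _) ⟨
  S + ((w ∸ f m) + f m + F)   ≡⟨ cong (λ x → S + (x + F)) (m∸n+n≡m (f≤w m)) ⟩
  S + (w + F)                 ≡⟨ cong (S +_) (+-comm w F) ⟩
  S + (F + w)                 ≡⟨ +-assoc S F w ⟨
  S + F + w                   ≡⟨ cong (_+ w) (sum<-∸ f m f≤w) ⟩
  m * w + w                   ≡⟨ +-comm (m * w) w ⟩
  suc m * w                   ∎
  where
  open ≡-Reasoning
  S = sum< (λ i → w ∸ f i) m
  F = sum< f m

-- Take the pointwise least sequence that starts at 0, grows by at least lo, and can still
-- reach M with steps of at most hi.
interpolate : ∀ lo hi m M → (∀ i → lo i ≤ hi i) → sum< lo m ≤ M → M ≤ sum< hi m →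
  Σ (ℕ → ℕ) λ p → p 0 ≡ 0 × p m ≡ M × (∀ i → p i + lo i ≤ p (suc i) × p (suc i) ≤ p i + hi i)
interpolate lo hi m M lo≤hi Lo≤M M≤Hi = p , p0 , pm , λ i → lower i , upper i
  where
  open ≤-Reasoning
  H = sum< hi m
  q p : ℕ → ℕ
  -- From index `i` on at most `H − sum< hi i` can be gained, so at least `M` minus that must be
  -- present.
  q i = (M + sum< hi i) ∸ H
  p i = sum< lo i ⊔ q i
  p0 : p 0 ≡ 0
  p0 = m≤n⇒m∸n≡0 (subst (_≤ H) (≡.sym (+-identityʳ M)) M≤Hi)
  pm : p m ≡ M
  pm = trans (cong (sum< lo m ⊔_) (m+n∸n≡m M H)) (m≤n⇒m⊔n≡n Lo≤M)
  lower : ∀ i → p i + lo i ≤ p (suc i)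
  lower i = subst (_≤ p (suc i)) (≡.sym (+-distribʳ-⊔ (lo i) (sum< lo i) (q i)))
    (⊔-lub (m≤m⊔n _ _) (q-lower (≤-total H (M + sum< hi i))))
    where
    q-lower : H ≤ M + sum< hi i ⊎ M + sum< hi i ≤ H → q i + lo i ≤ p (suc i)
    q-lower (inj₁ H≤) = begin
      q i + lo i                    ≤⟨ +-monoʳ-≤ (q i) (lo≤hi i) ⟩
      q i + hi i                    ≡⟨ +-∸-comm (hi i) H≤ ⟨
      (M + sum< hi i + hi i) ∸ H    ≡⟨ cong (_∸ H) (+-assoc M _ _) ⟩
      q (suc i)                     ≤⟨ m≤n⊔m _ _ ⟩
      p (suc i)                     ∎
    q-lower (inj₂ ≤H) = begin
      q i + lo i          ≡⟨ cong (_+ lo i) (m≤n⇒m∸n≡0 ≤H) ⟩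
      lo i                ≤⟨ m≤n+m (lo i) (sum< lo i) ⟩
      sum< lo (suc i)     ≤⟨ m≤m⊔n _ _ ⟩
      p (suc i)           ∎
  upper : ∀ i → p (suc i) ≤ p i + hi i
  upper i = ⊔-lub (+-mono-≤ (m≤m⊔n (sum< lo i) (q i)) (lo≤hi i)) (m≤n+o⇒m∸n≤o (M + (sum< hi i + hi i)) H (begin
    M + (sum< hi i + hi i)   ≡⟨ +-assoc M _ _ ⟨
    M + sum< hi i + hi i     ≤⟨ +-monoˡ-≤ (hi i) (m≤n+m∸n (M + sum< hi i) H) ⟩
    H + q i + hi i           ≡⟨ +-assoc H _ _ ⟩
    H + (q i + hi i)         ≤⟨ +-monoʳ-≤ H (+-monoˡ-≤ (hi i) (m≤n⊔m (sum< lo i) (q i))) ⟩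
    H + (p i + hi i)         ∎))

-- Remainder with the junk value x %₀ 0 = 0.
_%₀_ : ℕ → ℕ → ℕ
x %₀ zero = 0
x %₀ w@(suc _) = x % w

%₀-< : ∀ x {w} → 0 < w → x %₀ w < w
%₀-< x {suc w} _ = m%n<n x (suc w)

%₀-distinct : ∀ w {x y} → x < y → y < w + x → x %₀ w ≢ y %₀ w
%₀-distinct zero x<y y<x = ⊥-elim (<-asym x<y y<x)
%₀-distinct w@(suc _) = %-distinct w

%₀-multiple : ∀ a w x → (a * w + x) %₀ w ≡ x %₀ w
%₀-multiple a zero x = refl
%₀-multiple a w@(suc _) x = trans (cong (_% w) (+-comm (a * w) x)) ([m+kn]%n≡m%n x a w)

index-injective : ∀ {A : Set} {xs : List A} {x y} (x∈ : x ∈ xs) (y∈ : y ∈ xs) →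
  toℕ (index x∈) ≡ toℕ (index y∈) → x ≡ y
index-injective {xs = xs} x∈ y∈ eq = trans (lookup-index x∈)
  (trans (cong (lookup xs) (Fin.toℕ-injective eq)) (≡.sym (lookup-index y∈)))

module _ {n : ℕ} {G : Graph n} {a : ℕ} (bl : CycleBlowup G a) where
  open CycleBlowup bl

  size : ℕ → ℕ
  size i = length (A i)

  size-cyclic : ∀ i → size (suc (2 * a) + i) ≡ size i
  size-cyclic i = cong length (cyclic i)

  total : ℕ
  total = sum< size (suc (2 * a))

  -- A vertex at index x of A i gets colour (p i + x) mod w, so A i occupies an interval of
  -- the circle of w colours; p runs around that circle exactly a times.
  blowup-colouring : Spanning → ∀ w → (∀ i → size i + size (suc i) ≤ w) → total ≤ a * w →
    ColourableOn G (allFin n) (length B + w)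
  -- A step of at least `size i` starts the interval of `A (suc i)` after that of `A i`; a step of
  -- at most `w − size (suc i)` ends it before that of `A i` comes round again.
  blowup-colouring cover w pairs total≤ with interpolate size (λ i → w ∸ size (suc i)) (suc (2 * a)) (a * w)
      (λ i → m+n≤o⇒m≤o∸n (size i) (pairs i)) total≤ room
    where
    slack : ℕ
    slack = sum< (λ i → w ∸ size (suc i)) (suc (2 * a))
    -- The largest steps add up to `(2 a + 1) w − total`, and `total ≤ a * w`.
    room : a * w ≤ slack
    room = +-cancelʳ-≤ total (a * w) _ (begin
      a * w + total ≤⟨ +-monoʳ-≤ (a * w) total≤ ⟩
      a * w + a * w ≡⟨ *-distribʳ-+ w a a ⟨
      (a + a) * w ≡⟨ cong (λ x → (a + x) * w) (+-identityʳ a) ⟨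
      2 * a * w ≤⟨ m≤n+m (2 * a * w) w ⟩
      suc (2 * a) * w ≡⟨ sum<-∸ (size ∘ suc) (suc (2 * a)) (λ i → ≤-trans (m≤n+m _ (size i)) (pairs i)) ⟨
      slack + sum< (size ∘ suc) (suc (2 * a)) ≡⟨ cong (slack +_)
        (sum<-shift size (suc (2 * a)) (trans (cong size (≡.sym (+-identityʳ _))) (size-cyclic 0))) ⟩
      slack + total ∎)
      where open ≤-Reasoning
  ... | p , p0 , pm , steps =
        (λ v → colour (cover v)) , (λ {v} _ → colour-< (cover v)) ,
        λ {u} {v} _ _ u~v → proper (cover u) (cover v) u~v
    where
    open ≤-Reasoning
    Place : Fin n → Set
    Place v = v ∈ B ⊎ (∃[ i ] i ≤ 2 * a × v ∈ A i)

    colour : ∀ {v} → Place v → ℕ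
    colour (inj₁ v∈B) = toℕ (index v∈B)
    colour (inj₂ (i , _ , v∈)) = length B + (p i + toℕ (index v∈)) %₀ w

    size≤w : ∀ i → size i ≤ w
    size≤w i = m+n≤o⇒m≤o (size i) (pairs i)

    colour-< : ∀ {v} (pl : Place v) → colour pl < length B + w
    colour-< (inj₁ v∈B) = <-≤-trans (Fin.toℕ<n (index v∈B)) (m≤m+n _ w)
    colour-< (inj₂ (i , _ , v∈)) = +-monoʳ-< (length B)
      (%₀-< (p i + toℕ (index v∈)) (≤-<-trans z≤n (<-≤-trans (Fin.toℕ<n (index v∈)) (size≤w i))))

    same : ∀ i {x y} → x < y → y < size i → (p i + x) %₀ w ≢ (p i + y) %₀ w
    same i {x} {y} x<y y< = %₀-distinct w (+-monoʳ-< (p i) x<y) (begin-strict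
      p i + y       <⟨ +-monoʳ-< (p i) (<-≤-trans y< (size≤w i)) ⟩
      p i + w       ≡⟨ +-comm (p i) w ⟩
      w + p i       ≤⟨ +-monoʳ-≤ w (m≤m+n (p i) x) ⟩
      w + (p i + x) ∎)

    successive : ∀ i {x y} → x < size i → y < size (suc i) → (p i + x) %₀ w ≢ (p (suc i) + y) %₀ w
    successive i {x} {y} x< y< = %₀-distinct w
      (begin-strict
        p i + x          <⟨ +-monoʳ-< (p i) x< ⟩
        p i + size i     ≤⟨ proj₁ (steps i) ⟩
        p (suc i)        ≤⟨ m≤m+n (p (suc i)) y ⟩
        p (suc i) + y    ∎)
      (begin-strict
        p (suc i) + y                                  ≤⟨ +-monoˡ-≤ y (proj₂ (steps i)) ⟩
        p i + (w ∸ size (suc i)) + y                   <⟨ +-monoʳ-< _ y< ⟩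
        p i + (w ∸ size (suc i)) + size (suc i)        ≡⟨ +-assoc (p i) _ _ ⟩
        p i + ((w ∸ size (suc i)) + size (suc i))      ≡⟨ cong (p i +_) (m∸n+n≡m (size≤w (suc i))) ⟩
        p i + w                                        ≡⟨ +-comm (p i) w ⟩
        w + p i                                        ≤⟨ +-monoʳ-≤ w (m≤m+n (p i) x) ⟩
        w + (p i + x)                                  ∎)

    ordered : ∀ {u v i j} → i < j → j ≤ 2 * a → (u∈ : u ∈ A i) (v∈ : v ∈ A j) → Adj G u v →
      (p i + toℕ (index u∈)) %₀ w ≢ (p j + toℕ (index v∈)) %₀ w
    ordered {u} {v} {i} {j} i<j j≤2a u∈ v∈ u~v with m≤n⇒m<n∨m≡n i<j
    ... | inj₂ refl = successive i (Fin.toℕ<n (index u∈)) (Fin.toℕ<n (index v∈))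
    ... | inj₁ 2+i≤j with m≤n⇒m<n∨m≡n (≤-trans (m∸n≤m j i) j≤2a)
    ...   | inj₁ j-i<2a = ⊥-elim (A-apart (j ∸ i) i (m+n≤o⇒m≤o∸n 2 2+i≤j) j-i<2a u∈
              (subst (λ k → v ∈ A k) (≡.sym (m∸n+n≡m (<⇒≤ i<j))) v∈) u~v)
    ...   | inj₂ j-i≡2a = λ eq → closing i≡0 u∈ (≡.sym eq)
      where
      j≡2a+i : j ≡ 2 * a + i
      j≡2a+i = trans (≡.sym (m∸n+n≡m (<⇒≤ i<j))) (cong (_+ i) j-i≡2a)
      i≡0 : i ≡ 0
      i≡0 = n≤0⇒n≡0 (+-cancelˡ-≤ (2 * a) i 0 (subst₂ _≤_ j≡2a+i (≡.sym (+-identityʳ (2 * a))) j≤2a))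
      -- `p` ends at `a * w`, which is 0 modulo `w`, so the interval of `A 0` serves also as the one
      -- that follows `A (2 * a)`.
      closing : ∀ {i} → i ≡ 0 → (u∈ : u ∈ A i) →
        (p j + toℕ (index v∈)) %₀ w ≢ (p i + toℕ (index u∈)) %₀ w
      closing refl u∈ eq = successive j (Fin.toℕ<n (index v∈)) x<
          (trans eq (trans (cong (λ z → (z + x) %₀ w) p0)
            (trans (≡.sym (%₀-multiple a w x)) (cong (λ z → (z + x) %₀ w) (≡.sym (trans (cong (p ∘ suc) j≡2a) pm))))))
        where
        x = toℕ (index u∈)
        j≡2a : j ≡ 2 * a
        j≡2a = trans j≡2a+i (trans (cong (2 * a +_) i≡0) (+-identityʳ _))
        x< : x < size (suc j)
        x< = subst (x <_) (≡.sym (trans (cong (size ∘ suc) (trans j≡2a (≡.sym (+-identityʳ _)))) (size-cyclic 0)))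
          (Fin.toℕ<n (index u∈))

    proper : ∀ {u v} (pu : Place u) (pv : Place v) → Adj G u v → colour pu ≢ colour pv
    proper (inj₁ u∈) (inj₁ v∈) u~v eq = adj⇒≢ G u~v (index-injective u∈ v∈ eq)
    proper (inj₁ u∈) (inj₂ _) u~v eq = m+n≮m (length B) _ (subst (_< length B) eq (Fin.toℕ<n (index u∈)))
    proper (inj₂ _) (inj₁ v∈) u~v eq = m+n≮m (length B) _ (subst (_< length B) (≡.sym eq) (Fin.toℕ<n (index v∈)))
    proper (inj₂ (i , i≤ , u∈)) (inj₂ (j , j≤ , v∈)) u~v eq with +-cancelˡ-≡ (length B) _ _ eq | <-cmp i j
    ... | eq′ | tri< i<j _ _ = ordered i<j j≤ u∈ v∈ u~v eq′
    ... | eq′ | tri> _ _ j<i = ordered j<i i≤ v∈ u∈ (adj-sym G u~v) (≡.sym eq′)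
    ... | eq′ | tri≈ _ refl _ with <-cmp (toℕ (index u∈)) (toℕ (index v∈))
    ...   | tri< x<y _ _ = same i x<y (Fin.toℕ<n (index v∈)) eq′
    ...   | tri≈ _ x≡y _ = adj⇒≢ G u~v (index-injective u∈ v∈ x≡y)
    ...   | tri> _ _ y<x = same i y<x (Fin.toℕ<n (index u∈)) (≡.sym eq′)

-- Immersion in a dense blow-up

module _ {A : Set} (d : A) where

  -- Indices beyond the end of the list give the default d.
  nth : List A → ℕ → A
  nth [] _ = d
  nth (x ∷ xs) zero = x
  nth (x ∷ xs) (suc i) = nth xs i

  nth-∈ : ∀ xs {i} → i < length xs → nth xs i ∈ xs
  nth-∈ (x ∷ xs) {zero} _ = here refl
  nth-∈ (x ∷ xs) {suc i} i< = there (nth-∈ xs (≤-pred i<))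

  nth-injective : ∀ {xs i j} → Unique xs → i < length xs → j < length xs →
    nth xs i ≡ nth xs j → i ≡ j
  nth-injective {i = zero} {zero} (_ ∷ _) _ _ _ = refl
  nth-injective {xs = x ∷ xs} {zero} {suc j} (x≢ ∷ _) _ j< eq =
    ⊥-elim (All.lookup x≢ (nth-∈ xs (≤-pred j<)) eq)
  nth-injective {xs = x ∷ xs} {suc i} {zero} (x≢ ∷ _) i< _ eq =
    ⊥-elim (All.lookup x≢ (nth-∈ xs (≤-pred i<)) (≡.sym eq))
  nth-injective {xs = x ∷ xs} {suc i} {suc j} (_ ∷ uniq) i< j< eq =
    cong suc (nth-injective uniq (≤-pred i<) (≤-pred j<) eq)

  ∈-take⁻ : ∀ t xs {v} → v ∈ take t xs → v ∈ xs × ∃[ i ] i < t × v ≡ nth xs i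
  ∈-take⁻ (suc t) (x ∷ xs) (here refl) = here refl , 0 , z<s , refl
  ∈-take⁻ (suc t) (x ∷ xs) (there v∈) with ∈-take⁻ t xs v∈
  ... | v∈xs , i , i<t , eq = there v∈xs , suc i , s≤s i<t , eq

  ∈⇒nth : ∀ {xs v} → v ∈ xs → ∃[ i ] i < length xs × v ≡ nth xs i
  ∈⇒nth (here refl) = 0 , z<s , refl
  ∈⇒nth (there v∈) with ∈⇒nth v∈
  ... | i , i< , eq = suc i , s≤s i< , eq

interior-∷ : ∀ {A : Set} {x y w : A} P → w ∈ interior (x ∷ y ∷ P) → w ≡ y ⊎ w ∈ interior (y ∷ P)
interior-∷ (z ∷ P) (here w≡y) = inj₁ w≡y
interior-∷ (z ∷ P) (there w∈) = inj₂ w∈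

odd≢even : ∀ i j → suc (i * 2) ≢ j * 2
odd≢even (suc i) (suc j) eq = odd≢even i j (suc-injective (suc-injective eq))

module _ {n : ℕ} {G : Graph n} {a : ℕ} (bl : CycleBlowup G a) where
  open CycleBlowup bl

  AB-disjoint : ∀ {v} i → v ∈ B → v ∉ A i
  AB-disjoint i v∈B v∈A = adj⇒≢ G (B-A i v∈B v∈A) refl

  A-distinct : ∀ {v i j} → i < j → j ≤ 2 * a + i → v ∈ A i → v ∉ A j
  A-distinct {v} {i} {j} i<j j≤ v∈ v∈′ = A-disjoint (j ∸ i) i (m<n⇒0<n∸m i<j)
    (m≤n+o⇒m∸n≤o j i (subst (j ≤_) (+-comm (2 * a) i) j≤)) v∈
    (subst (λ k → v ∈ A k) (≡.sym (m∸n+n≡m (<⇒≤ i<j))) v∈′)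

  -- The indices 2, ..., `2 + 2 * a` are one full turn. It starts at 2 because detours run in `A 2`,
  -- ..., `A (2 * a + 1)`, where the last of these is `A 0`.
  A-level-unique : ∀ {v i j} → 2 ≤ i → i ≤ 2 + 2 * a → 2 ≤ j → j ≤ 2 + 2 * a → v ∈ A i → v ∈ A j → i ≡ j
  A-level-unique {v} {i} {j} 2≤i i≤ 2≤j j≤ v∈ v∈′ with <-cmp i j
  ... | tri< i<j _ _ = ⊥-elim (A-distinct i<j (≤-trans j≤ (≤-trans (≤-reflexive (+-comm 2 (2 * a))) (+-monoʳ-≤ (2 * a) 2≤i))) v∈ v∈′)
  ... | tri≈ _ i≡j _ = i≡j
  ... | tri> _ _ j<i = ⊥-elim (A-distinct j<i (≤-trans i≤ (≤-trans (≤-reflexive (+-comm 2 (2 * a))) (+-monoʳ-≤ (2 * a) 2≤j))) v∈′ v∈)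

  A-adjacent-clique : ∀ i → AllPairs (Adj G) (B ++ (A i ++ A (suc i)))
  A-adjacent-clique i = AllPairs.++⁺ (unique⇒allPairs B-unique B-clique)
    (AllPairs.++⁺ (unique⇒allPairs (A-unique i) (A-clique i))
                  (unique⇒allPairs (A-unique (suc i)) (A-clique (suc i)))
                  (All.tabulate λ u∈ → All.tabulate λ v∈ → A-next i u∈ v∈))
    (All.tabulate λ u∈ → All.tabulate λ v∈ → from u∈ (∈-++⁻ (A i) v∈))
    where
    from : ∀ {u v} → u ∈ B → v ∈ A i ⊎ v ∈ A (suc i) → Adj G u v
    from u∈ (inj₁ v∈) = B-A i u∈ v∈
    from u∈ (inj₂ v∈) = B-A (suc i) u∈ v∈

-- The branch vertices are B, A 0, A 1 and t vertices of A 2. The q-th of those t vertices is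
-- linked to the p-th vertex of A 0 by going around the cycle through the p-th vertex of every
-- odd class and the q-th vertex of every even class.
module Detours {n : ℕ} {G : Graph n} {b : ℕ} (bl : CycleBlowup G (2 + b)) (d : Fin n) (t : ℕ)
  (smallest : ∀ i → size bl 0 ≤ size bl i)
  (t≤ : ∀ j → j ≤ suc b → t ≤ size bl (2 + j * 2)) where
  open CycleBlowup bl

  a : ℕ
  a = 2 + b

  2a≡ : 2 * a ≡ 4 + b * 2
  2a≡ = *-comm 2 a

  A₀≡ : A (5 + b * 2) ≡ A 0
  A₀≡ = trans (cong A (trans (cong suc (≡.sym 2a≡)) (≡.sym (+-identityʳ _)))) (cyclic 0)

  odd even : ℕ → ℕ → Fin n
  odd j p = nth d (A (3 + j * 2)) p
  even j q = nth d (A (2 + j * 2)) q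

  last-odd : ∀ p → odd (suc b) p ≡ nth d (A 0) p
  last-odd p = cong (λ xs → nth d xs p) A₀≡

  -- Class indices fall by one at each step, from `2 * a + 1` (which is `A 0`) to 2 when
  -- `j = suc b`. The detour thus avoids `A 1`, and the fall is what shows that no vertex repeats.
  detour-tail detour : ℕ → ℕ → ℕ → List (Fin n)
  detour j p q = odd j p ∷ detour-tail j p q
  detour-tail zero p q = even 0 q ∷ []
  detour-tail (suc j) p q = even (suc j) q ∷ detour j p q

  odd-bound : ∀ {j} → j ≤ suc b → 3 + j * 2 ≤ 2 + 2 * a
  odd-bound {j} j≤ = subst (λ k → 3 + j * 2 ≤ 2 + k) (≡.sym 2a≡)
    (≤-trans (+-monoʳ-≤ 3 (*-monoˡ-≤ 2 j≤)) (n≤1+n _))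

  even-bound : ∀ {j} → j ≤ suc b → 2 + j * 2 ≤ 2 + 2 * a
  even-bound j≤ = ≤-trans (n≤1+n _) (odd-bound j≤)

  module _ {p q} (p< : p < size bl 0) (q< : q < t) where

    odd-∈ : ∀ j → odd j p ∈ A (3 + j * 2)
    odd-∈ j = nth-∈ d (A (3 + j * 2)) (<-≤-trans p< (smallest _))

    even-∈ : ∀ {j} → j ≤ suc b → even j q ∈ A (2 + j * 2)
    even-∈ {j} j≤ = nth-∈ d (A (2 + j * 2)) (<-≤-trans q< (t≤ j j≤))

    odd~even : ∀ {j} → j ≤ suc b → Adj G (odd j p) (even j q)
    odd~even {j} j≤ = adj-sym G (A-next (2 + j * 2) (even-∈ j≤) (odd-∈ j))

    even~odd : ∀ {j} → suc j ≤ suc b → Adj G (even (suc j) q) (odd j p)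
    even~odd {j} j≤ = adj-sym G (A-next (3 + j * 2) (odd-∈ j) (even-∈ j≤))

    detour-walk : ∀ j → j ≤ suc b → IsWalk G (odd j p) (even 0 q) (detour j p q)
    detour-walk zero j≤ = step (odd~even z≤n) (single _)
    detour-walk (suc j) j≤ = step (odd~even j≤) (step (even~odd j≤) (detour-walk j (≤-trans (n≤1+n j) j≤)))

    Below : ℕ → Fin n → Set
    Below k v = ∃[ i ] 2 ≤ i × i < k × v ∈ A i

    below-≢ : ∀ {u v k} → u ∈ A k → k ≤ 2 + 2 * a → Below k v → u ≢ v
    below-≢ u∈ k≤ (i , 2≤i , i<k , v∈) refl = <⇒≢ i<k (A-level-unique bl 2≤i (≤-trans (<⇒≤ i<k) k≤)
      (≤-trans 2≤i (<⇒≤ i<k)) k≤ v∈ u∈)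

    below-suc : ∀ {k v} → Below k v → Below (suc k) v
    below-suc (i , 2≤i , i<k , v∈) = i , 2≤i , m<n⇒m<1+n i<k , v∈

    tail-below : ∀ j → j ≤ suc b → All (Below (3 + j * 2)) (detour-tail j p q)
    detour-below : ∀ j → j ≤ suc b → All (Below (4 + j * 2)) (detour j p q)
    tail-below zero j≤ = (2 , ≤-refl , ≤-refl , even-∈ j≤) ∷ []
    tail-below (suc j) j≤ = (4 + j * 2 , s≤s (s≤s z≤n) , ≤-refl , even-∈ j≤) ∷
      All.map below-suc (detour-below j (≤-trans (n≤1+n j) j≤))
    detour-below j j≤ = (3 + j * 2 , s≤s (s≤s z≤n) , ≤-refl , odd-∈ j) ∷ All.map below-suc (tail-below j j≤)

    detour-unique : ∀ j → j ≤ suc b → Unique (detour j p q)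
    tail-unique : ∀ j → j ≤ suc b → Unique (detour-tail j p q)
    detour-unique j j≤ = All.map (below-≢ (odd-∈ j) (odd-bound j≤)) (tail-below j j≤) ∷ tail-unique j j≤
    tail-unique zero j≤ = [] ∷ []
    tail-unique (suc j) j≤ =
      All.map (below-≢ (even-∈ j≤) (even-bound j≤)) (detour-below j (≤-trans (n≤1+n j) j≤)) ∷
      detour-unique j (≤-trans (n≤1+n j) j≤)

    tail-interior : ∀ j → j ≤ suc b → ∀ {x w} → w ∈ interior (x ∷ detour-tail j p q) →
      ∃[ i ] 3 ≤ i × i < 3 + j * 2 × w ∈ A i
    tail-interior (suc j) j≤ {x} w∈ with interior-∷ {x = x} (detour j p q) w∈
    ... | inj₁ refl = 4 + j * 2 , s≤s (s≤s (s≤s z≤n)) , ≤-refl , even-∈ j≤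
    ... | inj₂ w∈′ with interior-∷ (detour-tail j p q) w∈′
    ...   | inj₁ refl = 3 + j * 2 , s≤s (s≤s (s≤s z≤n)) , n≤1+n _ , odd-∈ j
    ...   | inj₂ w∈″ with tail-interior j (≤-trans (n≤1+n j) j≤) w∈″
    ...     | i , 3≤i , i< , w∈A = i , 3≤i , ≤-trans i< (m≤n+m _ 2) , w∈A

  DetourEdge : ℕ → ℕ → Fin n → Fin n → Set
  DetourEdge p q x y = ∃[ j ] ∃[ j′ ] j ≤ suc b × j′ ≤ suc b × (j′ ≡ j ⊎ j′ ≡ suc j) ×
    ((x ≡ odd j p × y ≡ even j′ q) ⊎ (y ≡ odd j p × x ≡ even j′ q))

  detour-edge : ∀ {x y p q} j → j ≤ suc b → UsesEdge x y (detour j p q) → DetourEdge p q x y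
  detour-edge zero j≤ here-fw = 0 , 0 , j≤ , j≤ , inj₁ refl , inj₁ (refl , refl)
  detour-edge zero j≤ here-bw = 0 , 0 , j≤ , j≤ , inj₁ refl , inj₂ (refl , refl)
  detour-edge zero j≤ (there (there ()))
  detour-edge (suc j) j≤ here-fw = suc j , suc j , j≤ , j≤ , inj₁ refl , inj₁ (refl , refl)
  detour-edge (suc j) j≤ here-bw = suc j , suc j , j≤ , j≤ , inj₁ refl , inj₂ (refl , refl)
  detour-edge (suc j) j≤ (there here-fw) =
    j , suc j , ≤-trans (n≤1+n j) j≤ , j≤ , inj₂ refl , inj₂ (refl , refl)
  detour-edge (suc j) j≤ (there here-bw) =
    j , suc j , ≤-trans (n≤1+n j) j≤ , j≤ , inj₂ refl , inj₁ (refl , refl)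
  detour-edge (suc j) j≤ (there (there e)) = detour-edge j (≤-trans (n≤1+n j) j≤) e

  module _ {p q p′ q′} (p< : p < size bl 0) (q< : q < t) (p′< : p′ < size bl 0) (q′< : q′ < t) where

    odd-determines : ∀ {x j j′} → j ≤ suc b → j′ ≤ suc b → x ≡ odd j p → x ≡ odd j′ p′ → p ≡ p′
    odd-determines {j = j} {j′} j≤ j′≤ refl eq
      with *-cancelʳ-≡ j j′ 2 (+-cancelˡ-≡ 3 _ _ (A-level-unique bl (s≤s (s≤s z≤n)) (odd-bound j≤)
             (s≤s (s≤s z≤n)) (odd-bound j′≤) (odd-∈ p< q< j) (subst (_∈ A (3 + j′ * 2)) (≡.sym eq) (odd-∈ p′< q′< j′))))
    ... | refl = nth-injective d (A-unique _) (<-≤-trans p< (smallest _)) (<-≤-trans p′< (smallest _)) eq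

    even-determines : ∀ {x j j′} → j ≤ suc b → j′ ≤ suc b → x ≡ even j q → x ≡ even j′ q′ → q ≡ q′
    even-determines {j = j} {j′} j≤ j′≤ refl eq
      with *-cancelʳ-≡ j j′ 2 (+-cancelˡ-≡ 2 _ _ (A-level-unique bl (s≤s (s≤s z≤n)) (even-bound j≤)
             (s≤s (s≤s z≤n)) (even-bound j′≤) (even-∈ p< q< j≤) (subst (_∈ A (2 + j′ * 2)) (≡.sym eq) (even-∈ p′< q′< j′≤))))
    ... | refl = nth-injective d (A-unique _) (<-≤-trans q< (t≤ j j≤)) (<-≤-trans q′< (t≤ j j≤)) eq

    odd-even-distinct : ∀ {x j j′} → j ≤ suc b → j′ ≤ suc b → x ≡ odd j p → x ≢ even j′ q′
    odd-even-distinct {j = j} {j′} j≤ j′≤ refl eq = odd≢even j j′ (+-cancelˡ-≡ 2 _ _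
      (trans (+-suc 2 (j * 2)) (A-level-unique bl (s≤s (s≤s z≤n)) (odd-bound j≤) (s≤s (s≤s z≤n)) (even-bound j′≤)
        (odd-∈ p< q< j) (subst (_∈ A (2 + j′ * 2)) (≡.sym eq) (even-∈ p′< q′< j′≤)))))

    -- Within one turn a vertex has a single class index, so the odd end of an edge is told from its
    -- even end. Its place in the list of its class is then `p` or `q`.
    edge-determines : ∀ {x y} → DetourEdge p q x y → DetourEdge p′ q′ x y → p ≡ p′ × q ≡ q′
    edge-determines (j , i , j≤ , i≤ , _ , inj₁ (e , f)) (j′ , i′ , j′≤ , i′≤ , _ , inj₁ (e′ , f′)) =
      odd-determines j≤ j′≤ e e′ , even-determines i≤ i′≤ f f′
    edge-determines (j , i , j≤ , i≤ , _ , inj₁ (e , f)) (j′ , i′ , j′≤ , i′≤ , _ , inj₂ (e′ , f′)) =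
      ⊥-elim (odd-even-distinct j≤ i′≤ e f′)
    edge-determines (j , i , j≤ , i≤ , _ , inj₂ (e , f)) (j′ , i′ , j′≤ , i′≤ , _ , inj₁ (e′ , f′)) =
      ⊥-elim (odd-even-distinct j≤ i′≤ e f′)
    edge-determines (j , i , j≤ , i≤ , _ , inj₂ (e , f)) (j′ , i′ , j′≤ , i′≤ , _ , inj₂ (e′ , f′)) =
      odd-determines j≤ j′≤ e e′ , even-determines i≤ i′≤ f f′

  branches : List (Fin n)
  branches = B ++ (A 0 ++ (A 1 ++ take t (A 2)))

  Outer : Fin n → Set
  Outer v = v ∈ B ⊎ (∃[ i ] i ≤ 2 × v ∈ A i)

  branch-outer : ∀ {v} → v ∈ branches → Outer v
  branch-outer v∈ with ∈-++⁻ B v∈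
  ... | inj₁ v∈B = inj₁ v∈B
  ... | inj₂ v∈′ with ∈-++⁻ (A 0) v∈′
  ...   | inj₁ v∈0 = inj₂ (0 , z≤n , v∈0)
  ...   | inj₂ v∈″ with ∈-++⁻ (A 1) v∈″
  ...     | inj₁ v∈1 = inj₂ (1 , s≤s z≤n , v∈1)
  ...     | inj₂ v∈X = inj₂ (2 , ≤-refl , proj₁ (∈-take⁻ d t (A 2) v∈X))

  outer-∉-inner : ∀ {v i} → Outer v → 3 ≤ i → i ≤ 2 * a → v ∉ A i
  outer-∉-inner (inj₁ v∈B) _ _ = AB-disjoint bl _ v∈B
  outer-∉-inner {i = i} (inj₂ (k , k≤2 , v∈)) 3≤i i≤ =
    A-distinct bl (≤-<-trans k≤2 3≤i) (≤-trans i≤ (m≤m+n (2 * a) k)) v∈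

  Detour : Fin n → Fin n → Set
  Detour u v = ∃[ p ] ∃[ q ] p < size bl 0 × q < t × u ≡ nth d (A 0) p × v ≡ nth d (A 2) q

  route : ∀ {u v} → Detour u v → List (Fin n)
  route (p , q , _) = detour (suc b) p q

  route-path : ∀ {u v} (r : Detour u v) → IsPath G u v (route r)
  route-path (p , q , p< , q< , refl , refl) =
    subst (λ u → IsWalk G u (even 0 q) (detour (suc b) p q)) (last-odd p) (detour-walk p< q< (suc b) ≤-refl) ,
    detour-unique p< q< (suc b) ≤-refl

  route-avoids : ∀ {u v w} (r : Detour u v) → w ∈ branches → w ∉ interior (route r)
  route-avoids (p , q , p< , q< , _) w∈ w∈int with tail-interior p< q< (suc b) ≤-refl {x = odd (suc b) p} w∈int
  ... | i , 3≤i , i< , w∈A =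
    outer-∉-inner (branch-outer w∈) 3≤i (subst (i ≤_) (≡.sym 2a≡) (≤-pred i<)) w∈A

  -- Every edge has an end in one of `A 3`, ..., `A (2 * a)`: its even end, unless that lies in
  -- `A 2`, and then its odd end in `A 3`.
  route-leaves : ∀ {u v x y} (r : Detour u v) → UsesEdge x y (route r) → ¬ (x ∈ branches × y ∈ branches)
  route-leaves (p , q , p< , q< , _) e (x∈ , y∈) = decide (detour-edge (suc b) ≤-refl e)
    where
    clash : ∀ {u v j j′} → j ≤ suc b → j′ ≤ suc b → j′ ≡ j ⊎ j′ ≡ suc j →
      u ≡ odd j p → v ≡ even j′ q → Outer u → Outer v → ⊥
    clash {j = j} {suc j′} _ j′≤ _ _ refl _ outer = outer-∉-inner outer (s≤s (s≤s (s≤s z≤n)))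
      (subst (4 + j′ * 2 ≤_) (≡.sym 2a≡) (+-monoʳ-≤ 4 (*-monoˡ-≤ 2 (≤-pred j′≤)))) (even-∈ p< q< j′≤)
    clash {j = zero} {zero} j≤ j′≤ (inj₁ refl) refl _ outer _ =
      outer-∉-inner outer ≤-refl (subst (3 ≤_) (≡.sym 2a≡) (s≤s (s≤s (s≤s z≤n)))) (odd-∈ p< q< 0)
    decide : ¬ DetourEdge p q _ _
    decide (j , j′ , j≤ , j′≤ , adjacent , inj₁ (e , f)) =
      clash j≤ j′≤ adjacent e f (branch-outer x∈) (branch-outer y∈)
    decide (j , j′ , j≤ , j′≤ , adjacent , inj₂ (e , f)) =
      clash j≤ j′≤ adjacent e f (branch-outer y∈) (branch-outer x∈)

  route-ends : ∀ {u v u′ v′ x y} (r : Detour u v) (r′ : Detour u′ v′) →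
    UsesEdge x y (route r) → UsesEdge x y (route r′) → u ≡ u′ × v ≡ v′
  route-ends (p , q , p< , q< , refl , refl) (p′ , q′ , p′< , q′< , refl , refl) e e′
    with edge-determines p< q< p′< q′< (detour-edge (suc b) ≤-refl e) (detour-edge (suc b) ≤-refl e′)
  ... | refl , refl = refl , refl

  Linked : Fin n → Fin n → Set
  Linked u v = u ≢ v × (Adj G u v ⊎ Detour u v)

  adjacent : ∀ {u v} → Adj G u v → Linked u v
  adjacent e = adj⇒≢ G e , inj₁ e

  branches-linked : AllPairs Linked branches
  branches-linked = AllPairs.++⁺ (clique B-unique B-clique)
    (AllPairs.++⁺ (clique (A-unique 0) (A-clique 0))
      (AllPairs.++⁺ (clique (A-unique 1) (A-clique 1))
        (AllPairs.take⁺ t (clique (A-unique 2) (A-clique 2)))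
        (All.tabulate λ u∈ → All.tabulate λ v∈ → adjacent (A-next 1 u∈ (proj₁ (∈-take⁻ d t (A 2) v∈)))))
      (All.tabulate λ u∈ → All.tabulate λ v∈ → from-A₀ u∈ (∈-++⁻ (A 1) v∈)))
    (All.tabulate λ u∈ → All.tabulate λ v∈ → from-B u∈ (∈-++⁻ (A 0) v∈))
    where
    clique : ∀ {xs} → Unique xs → (∀ {u v} → u ∈ xs → v ∈ xs → u ≢ v → Adj G u v) → AllPairs Linked xs
    clique uniq adj = unique⇒allPairs uniq λ u∈ v∈ u≢v → adjacent (adj u∈ v∈ u≢v)
    from-A₀ : ∀ {u v} → u ∈ A 0 → v ∈ A 1 ⊎ v ∈ take t (A 2) → Linked u v
    from-A₀ u∈ (inj₁ v∈) = adjacent (A-next 0 u∈ v∈)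
    from-A₀ u∈ (inj₂ v∈) with ∈⇒nth d u∈ | ∈-take⁻ d t (A 2) v∈
    ... | p , p< , u≡ | v∈2 , q , q< , v≡ =
      (λ { refl → A-distinct bl z<s (s≤s (s≤s z≤n)) u∈ v∈2 }) , inj₂ (p , q , p< , q< , u≡ , v≡)
    from-B : ∀ {u v} → u ∈ B → v ∈ A 0 ⊎ v ∈ A 1 ++ take t (A 2) → Linked u v
    from-B u∈ (inj₁ v∈) = adjacent (B-A 0 u∈ v∈)
    from-B u∈ (inj₂ v∈) with ∈-++⁻ (A 1) v∈
    ... | inj₁ v∈1 = adjacent (B-A 1 u∈ v∈1)
    ... | inj₂ v∈X = adjacent (B-A 2 u∈ (proj₁ (∈-take⁻ d t (A 2) v∈X)))

  detour-immersion : ImmersesComplete G (length branches)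
  detour-immersion = immersion G (AllPairs.map proj₁ branches-linked) {D = Detour} route
    route-path route-avoids route-leaves route-ends (AllPairs.map proj₂ branches-linked)

  length-branches : length branches ≡ length B + (size bl 0 + (size bl 1 + t))
  length-branches = trans (length-++ B) (cong (length B +_)
    (trans (length-++ (A 0)) (cong (size bl 0 +_)
      (trans (length-++ (A 1)) (cong (size bl 1 +_)
        (trans (length-take t (A 2)) (m≤n⇒m⊓n≡m (t≤ 0 z≤n))))))))

-- Rotating the smallest class to the front, and the choice between colouring and immersion

periodic-∀ : ∀ m .{{_ : NonZero m}} (Q : ℕ → Set) → (∀ i → Q i → Q (m + i)) →
  (∀ i → i < m → Q i) → ∀ i → Q i
periodic-∀ m Q shift base i = subst Q (≡.sym (trans (m≡m%n+[m/n]*n i m) (+-comm (i % m) _))) (go (i / m))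
  where
  go : ∀ q → Q (q * m + i % m)
  go zero = base (i % m) (m%n<n i m)
  go (suc q) = subst Q (≡.sym (+-assoc m (q * m) (i % m))) (shift _ (go q))

argmin : ∀ (f : ℕ → ℕ) N → ∃[ r ] (∀ i → i ≤ N → f r ≤ f i)
argmin f zero = 0 , λ { zero _ → ≤-refl }
argmin f (suc N) with argmin f N
... | r , min with ≤-total (f r) (f (suc N))
...   | inj₁ fr≤ = r , λ i i≤ → case (m≤n⇒m<n∨m≡n i≤)
  where
  case : ∀ {i} → i < suc N ⊎ i ≡ suc N → f r ≤ f i
  case (inj₁ i<) = min _ (≤-pred i<)
  case (inj₂ refl) = fr≤
...   | inj₂ ≤fr = suc N , λ i i≤ → case (m≤n⇒m<n∨m≡n i≤)
  where
  case : ∀ {i} → i < suc N ⊎ i ≡ suc N → f (suc N) ≤ f i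
  case (inj₁ i<) = ≤-trans ≤fr (min _ (≤-pred i<))
  case (inj₂ refl) = ≤-refl

rotate : ∀ {n} {G : Graph n} {a} → CycleBlowup G a → CycleBlowup G a
rotate {a = a} bl = record
  { A = A ∘ suc
  ; B = B
  ; cyclic = λ i → trans (cong A (≡.sym (+-suc (suc (2 * a)) i))) (cyclic (suc i))
  ; A-unique = A-unique ∘ suc
  ; B-unique = B-unique
  ; A-disjoint = λ {v} e i 0<e e≤ v∈ → subst (λ k → ¬ (v ∈ A k)) (+-suc e i) (A-disjoint e (suc i) 0<e e≤ v∈)
  ; B-clique = B-clique
  ; B-A = B-A ∘ suc
  ; A-clique = A-clique ∘ suc
  ; A-next = A-next ∘ suc
  ; A-apart = λ {u} {v} e i 2≤e e< u∈ v∈ →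
      A-apart e (suc i) 2≤e e< u∈ (subst (λ k → v ∈ A k) (≡.sym (+-suc e i)) v∈)
  }
  where
  open CycleBlowup bl

module _ {n : ℕ} {G : Graph n} {a : ℕ} (bl : CycleBlowup G a) where
  open CycleBlowup bl

  -- The remaining classes split into a − 1 pairs of consecutive classes, each of size at most w.
  even-class-large : ∀ {w} → (∀ i → size bl i + size bl (suc i) ≤ w) → a * w < total bl →
    ∀ j → j < a → w < size bl 0 + size bl 1 + size bl (2 + j * 2)
  even-class-large {w} pairs dense j j<a = +-cancelʳ-≤ (j * w + l * w) (suc w) _ (begin
      suc w + (j * w + l * w)               ≡⟨ cong (suc w +_) (*-distribʳ-+ w j l) ⟨
      suc (w + (j + l) * w)                 ≡⟨ cong (λ k → suc (k * w)) 1+j+l≡a ⟩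
      suc (a * w)                           ≤⟨ dense ⟩
      sum< s (suc (2 * a))                  ≡⟨ cong (sum< s) split ⟩
      sum< s (2 + (j * 2 + suc (l * 2)))    ≡⟨ sum<-+ s 2 _ ⟩
      s01 + sum< (λ i → s (2 + i)) (j * 2 + suc (l * 2))
        ≡⟨ cong (s01 +_) (sum<-+ (λ i → s (2 + i)) (j * 2) (suc (l * 2))) ⟩
      s01 + (S₁ + sum< (λ i → s (2 + (j * 2 + i))) (suc (l * 2)))
        ≡⟨ cong (λ x → s01 + (S₁ + x)) (sum<-+ (λ i → s (2 + (j * 2 + i))) 1 (l * 2)) ⟩
      s01 + (S₁ + (s (2 + (j * 2 + 0)) + S₂))
        ≡⟨ cong (λ x → s01 + (S₁ + (s (2 + x) + S₂))) (+-identityʳ (j * 2)) ⟩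
      s01 + (S₁ + (s (2 + j * 2) + S₂))
        ≤⟨ +-monoʳ-≤ s01 (+-mono-≤ S₁≤ (+-monoʳ-≤ (s (2 + j * 2)) S₂≤)) ⟩
      s01 + (j * w + (s (2 + j * 2) + l * w))
        ≡⟨ cong (s01 +_) (+-assoc (j * w) _ _) ⟨
      s01 + (j * w + s (2 + j * 2) + l * w)
        ≡⟨ cong (λ x → s01 + (x + l * w)) (+-comm (j * w) _) ⟩
      s01 + (s (2 + j * 2) + j * w + l * w)
        ≡⟨ cong (s01 +_) (+-assoc (s (2 + j * 2)) _ _) ⟩
      s01 + (s (2 + j * 2) + (j * w + l * w))
        ≡⟨ +-assoc s01 _ _ ⟨
      s01 + s (2 + j * 2) + (j * w + l * w) ∎)
    where
    open ≤-Reasoning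
    s = size bl
    s01 = s 0 + s 1
    -- `j` pairs lie between `A 1` and `A (2 + j * 2)`, and `l` pairs after it up to `A (2 * a)`.
    l = a ∸ suc j
    S₁ = sum< (λ i → s (2 + i)) (j * 2)
    S₂ = sum< (λ i → s (2 + (j * 2 + suc i))) (l * 2)
    1+j+l≡a : suc (j + l) ≡ a
    1+j+l≡a = m+[n∸m]≡n j<a
    S₁≤ : S₁ ≤ j * w
    S₁≤ = sum<-pairs (λ i → s (2 + i)) (λ i → pairs (2 + i)) j
    S₂≤ : S₂ ≤ l * w
    S₂≤ = sum<-pairs (λ i → s (2 + (j * 2 + suc i)))
      (λ i → subst (λ x → s (2 + (j * 2 + suc i)) + s (2 + x) ≤ w) (≡.sym (+-suc (j * 2) (suc i))) (pairs _)) l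
    split : suc (2 * a) ≡ 2 + (j * 2 + suc (l * 2))
    split = trans (cong suc (trans (*-comm 2 a) (cong (_* 2) (≡.sym 1+j+l≡a))))
      (cong (2 +_) (trans (cong suc (*-distribʳ-+ 2 j l)) (≡.sym (+-suc (j * 2) (l * 2)))))

dense-immersion₀ : ∀ {n} {G : Graph n} {a : ℕ} (bl : CycleBlowup G a) → 2 ≤ a → ∀ {w} →
  (∀ i → size bl i + size bl (suc i) ≤ w) → a * w < total bl → (∀ i → size bl 0 ≤ size bl i) →
  ImmersesComplete G (length (CycleBlowup.B bl) + suc w)
dense-immersion₀ {n} {G} {suc (suc b)} bl (s≤s (s≤s z≤n)) {w} pairs dense smallest =
  subst (ImmersesComplete G) (trans length-branches (cong (length B +_)
    (trans (≡.sym (+-assoc (size bl 0) (size bl 1) t)) (m+[n∸m]≡n (m≤n⇒m≤1+n (pairs 0))))))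
    detour-immersion
  where
  open CycleBlowup bl
  -- Chosen so that `A 0`, `A 1` and the vertices taken from `A 2` number `w + 1`.
  t = suc w ∸ (size bl 0 + size bl 1)
  t≤ : ∀ j → j ≤ suc b → t ≤ size bl (2 + j * 2)
  t≤ j j≤ = m≤n+o⇒m∸n≤o (suc w) (size bl 0 + size bl 1) (even-class-large bl pairs dense j (s≤s j≤))
  -- A default value for `nth`. `A 2` is not empty: `A 0` and `A 1` have at most `w` vertices
  -- together, so `t` is positive.
  d : Fin n
  d = lookup (A 2) (fromℕ< (<-≤-trans (m<n⇒0<n∸m (s≤s (pairs 0))) (t≤ 0 z≤n)))
  open Detours bl d t smallest t≤

-- Each rotation lowers the index of the smallest class by one; by periodicity the total stays the
-- same.
dense-immersion : ∀ {n} {G : Graph n} {a : ℕ} (bl : CycleBlowup G a) → 2 ≤ a → ∀ {w} →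
  (∀ i → size bl i + size bl (suc i) ≤ w) → a * w < total bl →
  ∀ r → (∀ i → size bl r ≤ size bl i) → ImmersesComplete G (length (CycleBlowup.B bl) + suc w)
dense-immersion bl 2≤a pairs dense zero smallest = dense-immersion₀ bl 2≤a pairs dense smallest
dense-immersion {a = a} bl 2≤a {w} pairs dense (suc r) smallest =
  dense-immersion (rotate bl) 2≤a (pairs ∘ suc)
    (subst (a * w <_) (≡.sym (sum<-shift (size bl) (suc (2 * a))
      (trans (cong (size bl) (≡.sym (+-identityʳ _))) (size-cyclic bl 0)))) dense)
    r (smallest ∘ suc)

blowup-colourable-or-immersion : ∀ {n} {G : Graph n} {a : ℕ} (bl : CycleBlowup G a) → CycleBlowup.Spanning bl →
  2 ≤ a → ∀ k → ColourableOn G (allFin n) k ⊎ ImmersesComplete G (suc k)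
blowup-colourable-or-immersion {n} {G} {a} bl cover 2≤a k with k <? length (CycleBlowup.B bl)
... | yes k<B = inj₂ (clique-immersion G (A-adjacent-clique bl 0)
        (≤-trans k<B (≤-trans (m≤m+n _ _) (≤-reflexive (≡.sym (length-++ (CycleBlowup.B bl)))))))
... | no k≮B with least (λ i → ¬? (size bl i + size bl (suc i) ≤? k ∸ length (CycleBlowup.B bl))) (suc (2 * a))
...   | inj₂ (i , _ , heavy , _) = inj₂ (clique-immersion G (A-adjacent-clique bl i) (begin
          suc k                                              ≡⟨ cong suc (m+[n∸m]≡n (≮⇒≥ k≮B)) ⟨
          suc (length B + w)                                 ≡⟨ +-suc (length B) w ⟨
          length B + suc w                                   ≤⟨ +-monoʳ-≤ (length B) (≰⇒> heavy) ⟩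
          length B + (size bl i + size bl (suc i))           ≡⟨ cong (length B +_) (length-++ (A i)) ⟨
          length B + length (A i ++ A (suc i))               ≡⟨ length-++ B ⟨
          length (B ++ (A i ++ A (suc i)))                   ∎))
  where
  open CycleBlowup bl
  open ≤-Reasoning
  w = k ∸ length B
...   | inj₁ none = conclude (total bl ≤? a * w)
  where
  open CycleBlowup bl
  w = k ∸ length B
  B+w≡k : length B + w ≡ k
  B+w≡k = m+[n∸m]≡n (≮⇒≥ k≮B)
  pairs : ∀ i → size bl i + size bl (suc i) ≤ w
  pairs = periodic-∀ (suc (2 * a)) _
    (λ i → subst₂ (λ x y → x + y ≤ w) (≡.sym (size-cyclic bl i))
      (trans (≡.sym (size-cyclic bl (suc i))) (cong (size bl) (+-suc (suc (2 * a)) i))))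
    (λ i i< → decidable-stable (_ ≤? w) (none i i<))
  conclude : Dec (total bl ≤ a * w) → ColourableOn G (allFin n) k ⊎ ImmersesComplete G (suc k)
  conclude (yes sparse) = inj₁ (subst (ColourableOn G (allFin n)) B+w≡k (blowup-colouring bl cover w pairs sparse))
  conclude (no dense) with argmin (size bl) (2 * a)
  ... | r , min = inj₂ (subst (ImmersesComplete G) (trans (+-suc (length B) w) (cong suc B+w≡k))
    (dense-immersion bl 2≤a pairs (≰⇒> dense) r
      (periodic-∀ (suc (2 * a)) _ (λ i → subst (size bl r ≤_) (≡.sym (size-cyclic bl i))) (λ i i< → min i (≤-pred i<)))))

colourableOn-allFin : ∀ {n} {G : Graph n} {k} → ColourableOn G (allFin n) k → Colourable G k
colourableOn-allFin (c , c< , proper) = (λ v → fromℕ< (c< (∈-allFin v))) , λ u v u~v eq →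
  proper (∈-allFin u) (∈-allFin v) u~v (Fin.fromℕ<-injective _ _ _ _ eq)

colourable-or-immersion : ∀ {n} (G : Graph n) a → 2 ≤ a →
  (∀ S → IsIndependent G S → length S ≤ a) →
  (∀ ℓ → 4 ≤ ℓ → ℓ ≤ 2 * a → ¬ HasInducedCycle G ℓ) →
  ∀ k → Colourable G k ⊎ ImmersesComplete G (suc k)
colourable-or-immersion {n} G a 2≤a bounded holeless k
  with eliminate G k _ (allFin n) ≤-refl (Unique.allFin⁺ n)
... | inj₁ (inj₁ colouring) = inj₁ (colourableOn-allFin {G = G} colouring)
... | inj₁ (inj₂ (K , clique , k<)) = inj₂ (clique-immersion G clique k<)
... | inj₂ (L , P , r , cone) = from-hole (cone⇒hole cone)
  where
  open WithoutShortHoles G a bounded holeless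
  from-hole : Hole G a → Colourable G k ⊎ ImmersesComplete G (suc k)
  from-hole H with blowup-colourable-or-immersion hole⇒blowup hole⇒blowup-spanning 2≤a k
    where open HoleStructure G a 2≤a bounded holeless H
  ... | inj₁ colouring = inj₁ (colourableOn-allFin {G = G} colouring)
  ... | inj₂ immersion = inj₂ immersion

theorem1p5 : ∀ {n} (G : Graph n) (a k : ℕ) →
    IndependenceNumber G a → 2 ≤ a →
    (∀ ℓ → 4 ≤ ℓ → ℓ ≤ 2 * a → ¬ HasInducedCycle G ℓ) →
    ChromaticNumber G k →
    ImmersesComplete G k
theorem1p5 G a zero _ _ _ _ = clique-immersion G {K = []} [] z≤n
theorem1p5 G a (suc k) (_ , bounded) 2≤a holeless (_ , minimal)
  with colourable-or-immersion G a 2≤a bounded holeless k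
... | inj₁ colouring = ⊥-elim (minimal k (n<1+n k) colouring)
... | inj₂ immersion = immersion
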